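{- As $n\to\infty$ over powers of two, the total predicates $\varphi_0$ (validity of a canonical $0$-certificate descriptor) and $\varphi_1$ (being a clean matching pair) defined in the context satisfy \[ \widetilde{\deg}(\varphi_0)=\widetilde{O}(\sqrt n)\qquad\text{and}\qquad \widetilde{\deg}(\varphi_1)=\widetilde{O}(\sqrt n). \]
   Context: Parameters. $n=2^\ell$ is a power of two, large enough that $\ell=\log_2 n\ge5$; $M:=\lfloor n^{(\ell+1)/(\ell+2)}\rfloor$ (so $1\le M<n$) and $L:=\ell n$. Fix a bijection between $\{0,1\}^\ell$ and $[n]=\{1,\dots,n\}$, so that each $\ell$-bit string names an element of $[n]$. Fix maps $r_1,\dots,r_\ell:[n]\times[n]\to[n]$ with the property (such maps exist) that for every $S\subseteq[n]$ with $|S|\le n^{(\ell+1)/(\ell+2)}$, $|\{(i,j)\in S\times S:\ r_k(i,j)\in S\ \forall k\in[\ell]\}|\le L$. Inputs. $x\in\{0,1\}^{2n^2}$ has coordinates $x_{i,j,b}$, $i,j\in[n]$, $b\in\{1,2\}$, viewed as an $n\times n$ matrix with $(i,j)$ entry $(x_{i,j,1},x_{i,j,2})$. Entries $(a_1,a_2),(b_1,b_2)$ match if $(a_1\wedge b_1)\vee(a_2\wedge b_2)=1$; two distinct rows match if their entries match in every column. A row is bad if some entry of it is $(0,0)$. An ordered pair $(i_1,i_2)$ is a clean matching pair on $x$ if $i_1\neq i_2$, rows $i_1,i_2$ of $x$ match, and none of the rows $r_1(i_1,i_2),\dots,r_\ell(i_1,i_2)$ of $x$ is bad. Membership. For a list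 $A=(a_1,\dots,a_M)\in[n]^M$ (not necessarily sorted) and $i\in[n]$, $\operatorname{mem}_A(i)\in\{0,1\}$ is the output of this search: start with $\lambda=1,\mu=M+1$; while $\lambda<\mu$, let $m=\lfloor(\lambda+\mu)/2\rfloor$, and if $a_m<i$ set $\lambda:=m+1$, else set $\mu:=m$; at the end output $1$ iff $\lambda\le M$ and $a_\lambda=i$. Descriptors and validity. A canonical $0$-certificate descriptor is a pair $(j,A)$ with $j\in[n]$, $A\in[n]^M$, encoded by $(1+M)\log n$ bits. For $u\ne v$ let $E_A(u,v)=\operatorname{mem}_A(u)\operatorname{mem}_A(v)\prod_{k=1}^\ell\operatorname{mem}_A(r_k(u,v))$, $Z_{u,v}=(1-x_{u,v,1})(1-x_{v,v,2})$, and $W(A,x)=\sum_{u\neq v}E_A(u,v)(1-Z_{u,v})$, the sum over ordered pairs of distinct $u,v\in[n]$. The descriptor $(j,A)$ is valid on $x$ if (K) for all $i\in[n]$, $\operatorname{mem}_A(i)=1$ or $(x_{i,j,1},x_{i,j,2})=(0,0)$; and (R) $W(A,x)=0$. Predicates. $\varphi_0(x,(j,A))=1$ iff $(j,A)$ is valid on $x$, a total Boolean function of $2n^2+(1+M)\log n$ bits. $\varphi_1(x,(i_1,i_2))=1$ iff $(i_1,i_2)$ is a clean matching pair on $x$, a total Boolean function of $2n^2+2\log n$ bits. For a total Boolean function $g$ on $\{0,1\}^N$, $\widetilde{\deg}(g)$ is the least degree of a real polynomial $p$ with $|p(x)-g(x)|\le1/3$ for all $x\in\{0,1\}^N$. $\widetilde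 O$ suppresses factors polylogarithmic in $n$; logarithms are base $2$. -}

module Defs where

open import Data.Bool using (Bool; true; false; _∧_; _∨_; if_then_else_)
open import Data.Bool.Properties using () renaming (_≟_ to _≟ᵇ_)
open import Data.Fin using (Fin; zero; suc; fromℕ<; combine; _↑ˡ_; _↑ʳ_)
open import Data.Fin.Properties using (all?; any?; _≟_; _<?_)
open import Data.Fin.Subset using (Subset; ∣_∣)
open import Data.Fin.Subset.Properties using (_∈?_)
open import Data.List using (List; []; _∷_; map; foldr; filter; length; allFin; cartesianProduct)
open import Data.Nat using (ℕ; zero; suc; _+_; _*_; _∸_; _^_; _≤_; _<_; _⊔_; _/_; z≤n; s≤s; s≤s⁻¹)
open import Data.Nat.ListAction using (sum; product)
import Data.Nat.Properties as ℕP
open import Data.Nat.DivMod using (m<n*o⇒m/o<n)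
open import Data.Product using (Σ; ∃; ∃-syntax; _×_; _,_; proj₁; proj₂)
open import Data.Rational using (ℚ; 0ℚ; 1ℚ; ½; Positive; 1/_)
import Data.Rational as ℚ
import Data.Rational.Properties as ℚP
open import Data.Rational.Solver using (module +-*-Solver)
import Data.Integer as ℤ
open import Data.Sum using (_⊎_; inj₁; inj₂)
open import Data.Vec using (Vec; lookup; tabulate)
open import Function using (_∘_)
open import Function.Bundles using (_↔_; Inverse; _⇔_; mk⇔)
open import Relation.Binary.PropositionalEquality using (_≡_; _≢_; refl; sym; trans; cong; cong₂; subst)
open import Relation.Nullary using (¬_; Dec; yes; no; does; contradiction)
open import Relation.Nullary.Decidable using (_×-dec_; _⊎-dec_; ¬?)

------------------------------------------------------------------------
-- Real numbers: Cauchy sequences of rationals, with pointwise operations.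
-- Two sequences denote the same real when each is ≤ᴿ the other.

record ℝ : Set where
  constructor mkℝ
  field
    seq    : ℕ → ℚ
    cauchy : ∀ ε → 0ℚ ℚ.< ε →
             ∃[ N ] (∀ m n → N ≤ m → N ≤ n → ℚ.∣ seq m ℚ.- seq n ∣ ℚ.≤ ε)

open ℝ public

infix 4 _≤ᴿ_

_≤ᴿ_ : ℝ → ℝ → Set
x ≤ᴿ y = ∀ ε → 0ℚ ℚ.< ε → ∃[ N ] (∀ n → N ≤ n → seq x n ℚ.≤ seq y n ℚ.+ ε)

private

  split : ∀ k ε → 0ℚ ℚ.< k → 0ℚ ℚ.< ε → ∃[ δ ] (0ℚ ℚ.< δ × k ℚ.* δ ≡ ε)
  split k ε 0<k 0<ε = δ , ℚP.positive⁻¹ δ {{δ-pos}} , kδ≡ε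
    where
    instance
      k-pos : Positive k
      k-pos = ℚ.positive 0<k
      k-nz : ℚ.NonZero k
      k-nz = ℚP.pos⇒nonZero k
    δ : ℚ
    δ = (1/ k) ℚ.* ε
    δ-pos : Positive δ
    δ-pos = ℚP.pos*pos⇒pos (1/ k) {{ℚP.1/pos⇒pos k}} ε {{ℚ.positive 0<ε}}
    kδ≡ε : k ℚ.* δ ≡ ε
    kδ≡ε = trans (sym (ℚP.*-assoc k (1/ k) ε))
             (trans (cong (ℚ._* ε) (ℚP.*-inverseʳ k)) (ℚP.*-identityˡ ε))

  halves : ∀ ε → ½ ℚ.* ε ℚ.+ ½ ℚ.* ε ≡ ε
  halves ε = trans (sym (ℚP.*-distribʳ-+ ε ½ ½)) (ℚP.*-identityˡ ε)

  0<½* : ∀ ε → 0ℚ ℚ.< ε → 0ℚ ℚ.< ½ ℚ.* ε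
  0<½* ε 0<ε = ℚP.positive⁻¹ _ {{ℚP.pos*pos⇒pos ½ ε {{ℚ.positive 0<ε}}}}

  bounded : ∀ x → ∃[ K ] ∃[ N ] (0ℚ ℚ.< K × (∀ n → N ≤ n → ℚ.∣ seq x n ∣ ℚ.≤ K))
  bounded x = K , N , 0<K , bound
    where
    N : ℕ
    N = proj₁ (cauchy x 1ℚ (ℚP.positive⁻¹ 1ℚ))
    K : ℚ
    K = 1ℚ ℚ.+ ℚ.∣ seq x N ∣
    0<K : 0ℚ ℚ.< K
    0<K = ℚP.+-mono-<-≤ (ℚP.positive⁻¹ 1ℚ) (ℚP.0≤∣p∣ (seq x N))
    open +-*-Solver
    bound : ∀ n → N ≤ n → ℚ.∣ seq x n ∣ ℚ.≤ K
    bound n N≤n = ℚP.≤-trans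
      (ℚP.≤-reflexive (cong ℚ.∣_∣
        (+-*-Solver.solve 2 (λ a b → a := (a :- b) :+ b) refl (seq x n) (seq x N))))
      (ℚP.≤-trans (ℚP.∣p+q∣≤∣p∣+∣q∣ (seq x n ℚ.- seq x N) (seq x N))
        (ℚP.+-monoˡ-≤ ℚ.∣ seq x N ∣
          (proj₂ (cauchy x 1ℚ (ℚP.positive⁻¹ 1ℚ)) n N N≤n ℕP.≤-refl)))

  ∣*∣≤ : ∀ {a b K δ} → ℚ.∣ a ∣ ℚ.≤ K → ℚ.∣ b ∣ ℚ.≤ δ → 0ℚ ℚ.< K → ℚ.∣ a ℚ.* b ∣ ℚ.≤ K ℚ.* δ
  ∣*∣≤ {a} {b} {K} {δ} a≤K b≤δ 0<K = ℚP.≤-trans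
    (ℚP.≤-reflexive (ℚP.∣p*q∣≡∣p∣*∣q∣ a b))
    (ℚP.≤-trans
      (ℚP.*-monoʳ-≤-nonNeg ℚ.∣ b ∣ {{ℚP.∣-∣-nonNeg b}} a≤K)
      (ℚP.*-monoˡ-≤-nonNeg K {{ℚP.pos⇒nonNeg K {{ℚ.positive 0<K}}}} b≤δ))

  abs-diff≤ : ∀ p q → ℚ.∣ p ∣ ℚ.- ℚ.∣ q ∣ ℚ.≤ ℚ.∣ p ℚ.- q ∣
  abs-diff≤ p q = ℚP.≤-trans
    (ℚP.+-monoˡ-≤ (ℚ.- ℚ.∣ q ∣) (ℚP.≤-trans
      (ℚP.≤-reflexive (cong ℚ.∣_∣ (+-*-Solver.solve 2 (λ u v → u := (u :- v) :+ v) refl p q)))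
      (ℚP.∣p+q∣≤∣p∣+∣q∣ (p ℚ.- q) q)))
    (ℚP.≤-reflexive (+-*-Solver.solve 2 (λ u v → (u :+ v) :- v := u) refl ℚ.∣ p ℚ.- q ∣ ℚ.∣ q ∣))
    where open +-*-Solver

  abs-shrinks : ∀ p q → ℚ.∣ ℚ.∣ p ∣ ℚ.- ℚ.∣ q ∣ ∣ ℚ.≤ ℚ.∣ p ℚ.- q ∣
  abs-shrinks p q with ℚP.∣p∣≡p∨∣p∣≡-p (ℚ.∣ p ∣ ℚ.- ℚ.∣ q ∣)
  ... | inj₁ e = ℚP.≤-trans (ℚP.≤-reflexive e) (abs-diff≤ p q)
  ... | inj₂ e = ℚP.≤-trans
    (ℚP.≤-reflexive (trans e (+-*-Solver.solve 2 (λ u v → :- (u :- v) := v :- u) refl ℚ.∣ p ∣ ℚ.∣ q ∣)))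
    (ℚP.≤-trans (abs-diff≤ q p)
      (ℚP.≤-reflexive (trans (sym (ℚP.∣-p∣≡∣p∣ (q ℚ.- p)))
        (cong ℚ.∣_∣ (+-*-Solver.solve 2 (λ u v → :- (v :- u) := u :- v) refl p q)))))
    where open +-*-Solver

fromℚ : ℚ → ℝ
fromℚ q = mkℝ (λ _ → q) λ ε 0<ε → 0 , λ _ _ _ _ →
  ℚP.≤-trans (ℚP.≤-reflexive (cong ℚ.∣_∣ (ℚP.+-inverseʳ q))) (ℚP.<⇒≤ 0<ε)

infixl 6 _+ᴿ_ _-ᴿ_
infixl 7 _*ᴿ_
infix  8 -ᴿ_

_+ᴿ_ : ℝ → ℝ → ℝ
x +ᴿ y = mkℝ (λ n → seq x n ℚ.+ seq y n) λ ε 0<ε →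
  let (Nx , hx) = cauchy x (½ ℚ.* ε) (0<½* ε 0<ε)
      (Ny , hy) = cauchy y (½ ℚ.* ε) (0<½* ε 0<ε)
  in Nx ⊔ Ny , λ m n N≤m N≤n → ℚP.≤-trans
       (ℚP.≤-reflexive (cong ℚ.∣_∣
         (+-*-Solver.solve 4 (λ a b c d → (a :+ b) :- (c :+ d) := (a :- c) :+ (b :- d)) refl
           (seq x m) (seq y m) (seq x n) (seq y n))))
       (ℚP.≤-trans (ℚP.∣p+q∣≤∣p∣+∣q∣ (seq x m ℚ.- seq x n) (seq y m ℚ.- seq y n))
         (ℚP.≤-trans
           (ℚP.+-mono-≤
             (hx m n (ℕP.≤-trans (ℕP.m≤m⊔n Nx Ny) N≤m) (ℕP.≤-trans (ℕP.m≤m⊔n Nx Ny) N≤n))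
             (hy m n (ℕP.≤-trans (ℕP.m≤n⊔m Nx Ny) N≤m) (ℕP.≤-trans (ℕP.m≤n⊔m Nx Ny) N≤n)))
           (ℚP.≤-reflexive (halves ε))))
  where open +-*-Solver

-ᴿ_ : ℝ → ℝ
-ᴿ x = mkℝ (λ n → ℚ.- seq x n) λ ε 0<ε →
  let (N , h) = cauchy x ε 0<ε
  in N , λ m n N≤m N≤n → ℚP.≤-trans
       (ℚP.≤-reflexive (trans
         (cong ℚ.∣_∣ (sym (ℚP.neg-distrib-+ (seq x m) (ℚ.- seq x n))))
         (ℚP.∣-p∣≡∣p∣ (seq x m ℚ.- seq x n))))
       (h m n N≤m N≤n)

_-ᴿ_ : ℝ → ℝ → ℝ
x -ᴿ y = x +ᴿ -ᴿ y

_*ᴿ_ : ℝ → ℝ → ℝ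
x *ᴿ y = mkℝ (λ n → seq x n ℚ.* seq y n) λ ε 0<ε →
  let (Kx , Bx , 0<Kx , bx) = bounded x
      (Ky , By , 0<Ky , by) = bounded y
      (δx , 0<δx , ex) = split Ky (½ ℚ.* ε) 0<Ky (0<½* ε 0<ε)
      (δy , 0<δy , ey) = split Kx (½ ℚ.* ε) 0<Kx (0<½* ε 0<ε)
      (Nx , hx) = cauchy x δx 0<δx
      (Ny , hy) = cauchy y δy 0<δy
      N = (Bx ⊔ By) ⊔ (Nx ⊔ Ny)
      Bx≤N = ℕP.≤-trans (ℕP.m≤m⊔n Bx By) (ℕP.m≤m⊔n (Bx ⊔ By) (Nx ⊔ Ny))
      By≤N = ℕP.≤-trans (ℕP.m≤n⊔m Bx By) (ℕP.m≤m⊔n (Bx ⊔ By) (Nx ⊔ Ny))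
      Nx≤N = ℕP.≤-trans (ℕP.m≤m⊔n Nx Ny) (ℕP.m≤n⊔m (Bx ⊔ By) (Nx ⊔ Ny))
      Ny≤N = ℕP.≤-trans (ℕP.m≤n⊔m Nx Ny) (ℕP.m≤n⊔m (Bx ⊔ By) (Nx ⊔ Ny))
  in N , λ m n N≤m N≤n → ℚP.≤-trans
       (ℚP.≤-reflexive (cong ℚ.∣_∣
         (+-*-Solver.solve 4 (λ a b c d → (a :* b) :- (c :* d) := (a :* (b :- d)) :+ (d :* (a :- c))) refl
           (seq x m) (seq y m) (seq x n) (seq y n))))
       (ℚP.≤-trans
         (ℚP.∣p+q∣≤∣p∣+∣q∣ (seq x m ℚ.* (seq y m ℚ.- seq y n)) (seq y n ℚ.* (seq x m ℚ.- seq x n)))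
         (ℚP.≤-trans
           (ℚP.+-mono-≤
             (∣*∣≤ (bx m (ℕP.≤-trans Bx≤N N≤m))
                   (hy m n (ℕP.≤-trans Ny≤N N≤m) (ℕP.≤-trans Ny≤N N≤n)) 0<Kx)
             (∣*∣≤ (by n (ℕP.≤-trans By≤N N≤n))
                   (hx m n (ℕP.≤-trans Nx≤N N≤m) (ℕP.≤-trans Nx≤N N≤n)) 0<Ky))
           (ℚP.≤-reflexive (trans (cong₂ ℚ._+_ ey ex) (halves ε)))))
  where open +-*-Solver

∣_∣ᴿ : ℝ → ℝ
∣ x ∣ᴿ = mkℝ (λ n → ℚ.∣ seq x n ∣) λ ε 0<ε →
  let (N , h) = cauchy x ε 0<ε
  in N , λ m n N≤m N≤n → ℚP.≤-trans (abs-shrinks (seq x m) (seq x n)) (h m n N≤m N≤n)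

0ᴿ 1ᴿ : ℝ
0ᴿ = fromℚ 0ℚ
1ᴿ = fromℚ 1ℚ

------------------------------------------------------------------------
-- Real polynomials and approximate degree

-- The list v₁ ∷ … ∷ vₖ ∷ [] stands for the monomial X_{v₁} ⋯ X_{vₖ};
-- variables may repeat.
Monomial : ℕ → Set
Monomial N = List (Fin N)

Polynomial : ℕ → Set
Polynomial N = List (ℝ × Monomial N)

-- This is the degree of the formal expression: terms may have coefficient
-- zero or cancel, so it bounds the degree of the polynomial from above, with
-- equality after collecting terms.  Least degrees over a class of polynomials
-- closed under collecting terms are therefore the usual ones.
degree : ∀ {N} → Polynomial N → ℕ
degree = foldr (λ t d → length (proj₂ t) ⊔ d) 0

evalMonomial : ∀ {N} → Monomial N → (Fin N → ℝ) → ℝ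
evalMonomial m x = foldr (λ v a → x v *ᴿ a) 1ᴿ m

eval : ∀ {N} → Polynomial N → (Fin N → ℝ) → ℝ
eval p x = foldr (λ t a → proj₁ t *ᴿ evalMonomial (proj₂ t) x +ᴿ a) 0ᴿ p

BooleanFunction : ℕ → Set
BooleanFunction N = Vec Bool N → Bool

bitᴿ : Bool → ℝ
bitᴿ b = if b then 1ᴿ else 0ᴿ

_Approximates_ : ∀ {N} → Polynomial N → BooleanFunction N → Set
p Approximates g =
  ∀ x → ∣ eval p (λ v → bitᴿ (lookup x v)) -ᴿ bitᴿ (g x) ∣ᴿ ≤ᴿ fromℚ (ℤ.+ 1 ℚ./ 3)

ApproxDegree≤ : ∀ {N} → BooleanFunction N → ℕ → Set
ApproxDegree≤ {N} g d = Σ (Polynomial N) λ p → degree p ≤ d × p Approximates g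

IsApproxDegree : ∀ {N} → BooleanFunction N → ℕ → Set
IsApproxDegree {N} g d =
  (Σ (Polynomial N) λ p → degree p ≡ d × p Approximates g) ×
  (∀ p → p Approximates g → d ≤ degree p)

approxDegree≤⇔ : ∀ {N} {g : BooleanFunction N} {d D} →
                 IsApproxDegree g d → (ApproxDegree≤ g D ⇔ d ≤ D)
approxDegree≤⇔ ((p , deg≡d , p≈g) , least) = mk⇔
  (λ (q , degq≤D , q≈g) → ℕP.≤-trans (least q q≈g) degq≤D)
  (λ d≤D → p , ℕP.≤-trans (ℕP.≤-reflexive deg≡d) d≤D , p≈g)

-- For n = 2^ℓ, the approximate degree of g ℓ is Õ(√n).  The bound
-- D ≤ √C · (log n)^{c/2} · √n is stated squared; ℓ₀ is the "n → ∞" threshold.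
-- The bound is imposed through ApproxDegree≤ because a least degree need not
-- be computable; see approxDegree≤⇔.
ApproxDegreeIsÕ√n : {N : ℕ → ℕ} → (∀ ℓ → 5 ≤ ℓ → BooleanFunction (N ℓ)) → Set
ApproxDegreeIsÕ√n g =
  ∃[ C ] ∃[ c ] ∃[ ℓ₀ ] (∀ ℓ (5≤ℓ : 5 ≤ ℓ) → ℓ₀ ≤ ℓ →
    ∃[ D ] (ApproxDegree≤ (g ℓ 5≤ℓ) D × D ^ 2 ≤ C * ℓ ^ c * 2 ^ ℓ))

------------------------------------------------------------------------
-- Parameters

-- For k ≥ 1: the largest m with m ^ k ≤ N (see floorRoot-spec).
floorRootUpTo : ℕ → ℕ → ℕ → ℕ
floorRootUpTo k N zero    = zero
floorRootUpTo k N (suc b) with suc b ^ k ℕP.≤? N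
... | yes _ = suc b
... | no  _ = floorRootUpTo k N b

floorRoot : ℕ → ℕ → ℕ
floorRoot k N = floorRootUpTo k N N

private

  root-≤ : ∀ k N b → floorRootUpTo (suc k) N b ^ suc k ≤ N
  root-≤ k N zero = z≤n
  root-≤ k N (suc b) with suc b ^ suc k ℕP.≤? N
  ... | yes p = p
  ... | no  _ = root-≤ k N b

  root-max : ∀ k N b m → m ≤ b → m ^ k ≤ N → m ≤ floorRootUpTo k N b
  root-max k N zero    m m≤b _ = m≤b
  root-max k N (suc b) m m≤b h with suc b ^ k ℕP.≤? N
  ... | yes _ = m≤b
  ... | no ¬p = root-max k N b m (s≤s⁻¹ (ℕP.≤∧≢⇒< m≤b λ { refl → ¬p h })) h

  m≤m^ : ∀ k m → m ≤ m ^ suc k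
  m≤m^ k zero    = z≤n
  m≤m^ k (suc m) = ℕP.m≤m*n (suc m) (suc m ^ k) {{ℕP.m^n≢0 (suc m) k}}

floorRoot-spec : ∀ k N m → m ^ suc k ≤ N ⇔ m ≤ floorRoot (suc k) N
floorRoot-spec k N m = mk⇔
  (λ h → root-max (suc k) N N m (ℕP.≤-trans (m≤m^ k m) h) h)
  (λ h → ℕP.≤-trans (ℕP.^-monoˡ-≤ (suc k) h) (root-≤ k N N))

size : ℕ → ℕ
size ℓ = 2 ^ ℓ

-- ⌊n^{(ℓ+1)/(ℓ+2)}⌋ as ⌊(n^{ℓ+1})^{1/(ℓ+2)}⌋, where n = 2^ℓ
listLength : ℕ → ℕ
listLength ℓ = floorRoot (2 + ℓ) (size ℓ ^ (1 + ℓ))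

pairs : ∀ n → List (Fin n × Fin n)
pairs n = cartesianProduct (allFin n) (allFin n)

record Parameters (ℓ : ℕ) : Set where
  field
    name : Vec Bool ℓ ↔ Fin (size ℓ)
    r    : Fin ℓ → Fin (size ℓ) → Fin (size ℓ) → Fin (size ℓ)
    -- the hypothesis |S| ≤ n^{(ℓ+1)/(ℓ+2)} is raised to the power ℓ+2
    r-sparse : ∀ (S : Subset (size ℓ)) → ∣ S ∣ ^ (2 + ℓ) ≤ size ℓ ^ (1 + ℓ) →
      length (filter (λ (i , j) → i ∈? S ×-dec j ∈? S ×-dec all? (λ k → r k i j ∈? S))
                     (pairs (size ℓ)))
        ≤ ℓ * size ℓ

------------------------------------------------------------------------
-- Membership by binary search

private
  midpoint< : ∀ {lo hi} → lo < hi → (lo + hi) / 2 < hi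
  midpoint< {lo} {hi} lo<hi = m<n*o⇒m/o<n (subst (lo + hi <_) 2hi (ℕP.+-monoˡ-< hi lo<hi))
    where
    2hi : hi + hi ≡ hi * 2
    2hi = trans (cong (hi +_) (sym (ℕP.+-identityʳ hi))) (ℕP.*-comm 2 hi)

-- Positions are counted from 0, so lo = λ - 1 and hi = μ - 1; since
-- ⌊(λ+μ)/2⌋ - 1 = ⌊(lo+hi)/2⌋ the run is the same as with positions 1, …, M.
-- The first argument is fuel; each iteration decreases hi - lo, so fuel M is
-- enough for the loop started on (0 , M) to exit with lo ≥ hi.
search : ∀ {n M} → Vec (Fin n) M → Fin n → ℕ → (lo hi : ℕ) → .(hi ≤ M) → ℕ
search A i zero       lo hi hi≤M = lo
search A i (suc fuel) lo hi hi≤M with lo ℕP.<? hi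
... | no  _     = lo
... | yes lo<hi =
  if does (lookup A (fromℕ< (ℕP.<-≤-trans (midpoint< lo<hi) hi≤M)) <? i)
  then search A i fuel (suc ((lo + hi) / 2)) hi hi≤M
  else search A i fuel lo ((lo + hi) / 2) (ℕP.≤-trans (ℕP.<⇒≤ (midpoint< lo<hi)) hi≤M)

mem : ∀ {n M} → Vec (Fin n) M → Fin n → Bool
mem {n} {M} A i with search A i M 0 M ℕP.≤-refl ℕP.<? M
... | yes lo<M = does (lookup A (fromℕ< lo<M) ≟ i)
... | no  _    = false

bit : Bool → ℕ
bit b = if b then 1 else 0

------------------------------------------------------------------------
-- The predicates

Matrix : ℕ → Set
Matrix n = Fin n → Fin n → Fin 2 → Bool

pattern b₁ = zero
pattern b₂ = suc zero

-- An input consists of the 2n² bits x_{i,j,b} followed by w blocks of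
-- ℓ = log n bits, each naming an element of [n].
inputBits : (ℓ w : ℕ) → ℕ
inputBits ℓ w = 2 * (size ℓ * size ℓ) + w * ℓ

module Predicates {ℓ : ℕ} (P : Parameters ℓ) where

  open Parameters P

  private
    n M : ℕ
    n = size ℓ
    M = listLength ℓ

  module _ (x : Matrix n) where

    EntryIsZero : Fin n → Fin n → Set
    EntryIsZero i j = x i j b₁ ≡ false × x i j b₂ ≡ false

    entryIsZero? : ∀ i j → Dec (EntryIsZero i j)
    entryIsZero? i j = (x i j b₁ ≟ᵇ false) ×-dec (x i j b₂ ≟ᵇ false)

    EntriesMatch : Fin n → Fin n → Fin n → Set
    EntriesMatch i₁ i₂ j = (x i₁ j b₁ ∧ x i₂ j b₁) ∨ (x i₁ j b₂ ∧ x i₂ j b₂) ≡ true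

    RowsMatch : Fin n → Fin n → Set
    RowsMatch i₁ i₂ = ∀ j → EntriesMatch i₁ i₂ j

    Bad : Fin n → Set
    Bad i = ∃[ j ] EntryIsZero i j

    CleanMatchingPair : Fin n → Fin n → Set
    CleanMatchingPair i₁ i₂ =
      i₁ ≢ i₂ × RowsMatch i₁ i₂ × (∀ k → ¬ Bad (r k i₁ i₂))

    cleanMatchingPair? : ∀ i₁ i₂ → Dec (CleanMatchingPair i₁ i₂)
    cleanMatchingPair? i₁ i₂ =
      ¬? (i₁ ≟ i₂) ×-dec
      all? (λ j → ((x i₁ j b₁ ∧ x i₂ j b₁) ∨ (x i₁ j b₂ ∧ x i₂ j b₂)) ≟ᵇ true) ×-dec
      all? (λ k → ¬? (any? (entryIsZero? (r k i₁ i₂))))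

    E : Vec (Fin n) M → Fin n → Fin n → ℕ
    E A u v = bit (mem A u) * bit (mem A v) * product (map (λ k → bit (mem A (r k u v))) (allFin ℓ))

    -- Truncated subtraction is exact here and in W, as both operands are 0 or 1.
    Z : Fin n → Fin n → ℕ
    Z u v = (1 ∸ bit (x u v b₁)) * (1 ∸ bit (x v v b₂))

    W : Vec (Fin n) M → ℕ
    W A = sum (map (λ (u , v) → E A u v * (1 ∸ Z u v))
                   (filter (λ (u , v) → ¬? (u ≟ v)) (pairs n)))

    Valid : Fin n → Vec (Fin n) M → Set
    Valid j A = (∀ i → mem A i ≡ true ⊎ EntryIsZero i j) × W A ≡ 0

    valid? : ∀ j A → Dec (Valid j A)
    valid? j A = all? (λ i → (mem A i ≟ᵇ true) ⊎-dec entryIsZero? i j) ×-dec (W A ℕP.≟ 0)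

  matrix : ∀ w → Vec Bool (inputBits ℓ w) → Matrix n
  matrix w z i j b = lookup z (combine b (combine i j) ↑ˡ (w * ℓ))

  word : ∀ w → Vec Bool (inputBits ℓ w) → Fin w → Fin n
  word w z t = Inverse.to name (tabulate λ k → lookup z (2 * (n * n) ↑ʳ combine t k))

  φ₀ : BooleanFunction (inputBits ℓ (1 + M))
  φ₀ z = does (valid? (matrix (1 + M) z) (word (1 + M) z zero) (tabulate (word (1 + M) z ∘ suc)))

  φ₁ : BooleanFunction (inputBits ℓ 2)
  φ₁ z = does (cleanMatchingPair? (matrix 2 z) (word 2 z zero) (word 2 z (suc zero)))

{-# OPTIONS --safe #-}

-- Count the violations of each condition: V z ∈ ℕ vanishes exactly on the inputs
-- accepted by the predicate.  A single violation is detected by polylog(n) adaptive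
-- queries (binary search reads O(log n) list entries), so V is a polynomial of
-- polylogarithmic degree in the bits.  Moreover V ≤ B for some B = O(n log n): for
-- φ₀ the elements found by mem form a set of size at most M, so r-sparse leaves at
-- most ℓn pairs with E = 1.  Composing V with a rescaled Chebyshev polynomial Tₑ,
-- e ≈ √(2B), which is at least 3 at V = 0 and lies in [-1,1] for 1 ≤ V ≤ B,
-- approximates the indicator of V = 0 up to 1/3.

module Submission where

open import Defs
open import Algebra.Bundles using (CommutativeRing)
open import Data.Bool using (Bool; true; false; not; if_then_else_; _∧_; _∨_)
open import Data.Bool.Properties using () renaming (_≟_ to _≟ᵇ_)
open import Data.Fin using (Fin; zero; suc; fromℕ<; combine; remQuot; _↑ʳ_)
import Data.Fin.Properties as FinP
open import Data.Fin.Subset using (Subset; ∣_∣; _∈_; _∪_; ⁅_⁆; ⊥)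
open import Data.Fin.Subset.Properties using (_∈?_; ∣⁅x⁆∣≡1; ∣⊥∣≡0; x∈⁅x⁆; x∈p∪q⁺)
open import Data.List using (List; []; _∷_; _++_; map; foldr; filter; length; allFin)
open import Data.List.Membership.Propositional using () renaming (_∈_ to _∈ᴸ_)
open import Data.List.Membership.Propositional.Properties using (∈-allFin)
open import Data.List.Properties using (length-++; length-tabulate; foldr-fusion; foldr-map)
open import Data.List.Relation.Unary.Any using (here; there)
open import Data.Nat using (ℕ; zero; suc; _≤_; _<_; z≤n; s≤s; NonZero)
import Data.Nat as ℕ
open import Data.Nat.DivMod using (m≡m%n+[m/n]*n; m%n<n; m<n*o⇒m/o<n)
open import Data.Nat.ListAction using (sum; product)
import Data.Nat.Properties as ℕP
open import Data.Nat.Tactic.RingSolver using (solve-∀)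
open import Data.Product using (∃-syntax; _×_; _,_; proj₁; proj₂)
open import Data.Rational using (ℚ; 0ℚ; 1ℚ; Positive)
import Data.Rational as ℚ
import Data.Rational.Properties as ℚP
open import Data.Rational.Solver using (module +-*-Solver)
open import Data.Sum using (_⊎_; inj₁; inj₂)
open import Data.Vec using (Vec; []; _∷_; lookup; tabulate)
import Data.Vec.Properties as VecP
open import Function using (_∘_)
open import Function.Bundles using (Inverse; Equivalence)
open import Relation.Binary.PropositionalEquality
open import Relation.Nullary using (¬_; Dec; yes; no; does; contradiction)
open import Relation.Nullary.Decidable using (_×-dec_; _⊎-dec_; ¬?; dec-true; dec-false)
open import Algebra.Properties.Semiring.Mult (CommutativeRing.semiring ℚP.+-*-commutativeRing)
  using (×-homo-+; ×1-homo-*) renaming (_×_ to _·_)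
open +-*-Solver using (solve; _:=_; _:+_; _:*_; _:-_; :-_; con)

-- Polynomials in bits

module _ where

  open import Data.Integer using (+_)
  open import Data.Rational using (_+_; _*_; _-_; -_; 1/_)

  bitℚ : Bool → ℚ
  bitℚ b = if b then 1ℚ else 0ℚ

  -- Rational coefficients suffice, and evaluating them in ℚ keeps the moduli of
  -- convergence carried by ℝ out of the way until approxDegree≤.
  Polynomialℚ : ℕ → Set
  Polynomialℚ N = List (ℚ × Monomial N)

  real : ∀ {N} → Polynomialℚ N → Polynomial N
  real = map λ (c , m) → fromℚ c , m

  seq-bitᴿ : ∀ b k → seq (bitᴿ b) k ≡ bitℚ b
  seq-bitᴿ true  k = refl
  seq-bitᴿ false k = refl

  module _ {N : ℕ} (z : Vec Bool N) where

    ⟦_⟧ᴹ : Monomial N → ℚ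
    ⟦_⟧ᴹ = foldr (λ v a → bitℚ (lookup z v) * a) 1ℚ

    ⟦_⟧ : Polynomialℚ N → ℚ
    ⟦_⟧ = foldr (λ (c , m) a → c * ⟦ m ⟧ᴹ + a) 0ℚ

    seq-evalMonomial : ∀ m k → seq (evalMonomial m (λ v → bitᴿ (lookup z v))) k ≡ ⟦ m ⟧ᴹ
    seq-evalMonomial m k = foldr-fusion (λ a → seq a k) 1ᴿ
      (λ v a → cong (_* seq a k) (seq-bitᴿ (lookup z v) k)) m

    -- Coefficients and bits are constant Cauchy sequences, so every index `k` already carries the
    -- exact rational value. This is why `approxDegree≤` can use the threshold 0.
    seq-eval : ∀ p k → seq (eval (real p) (λ v → bitᴿ (lookup z v))) k ≡ ⟦ p ⟧
    seq-eval p k = trans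
      (cong (λ a → seq a k) (foldr-map _ (λ (c , m) → fromℚ c , m) 0ᴿ p))
      (foldr-fusion (λ a → seq a k) 0ᴿ
        (λ (c , m) a → cong (λ w → c * w + seq a k) (seq-evalMonomial m k)) p)

  mulTerm : ∀ {N} → ℚ × Monomial N → Polynomialℚ N → Polynomialℚ N
  mulTerm (c , m) = map λ (c′ , m′) → c * c′ , m ++ m′

  mul : ∀ {N} → Polynomialℚ N → Polynomialℚ N → Polynomialℚ N
  mul []      q = []
  mul (t ∷ p) q = mulTerm t q ++ mul p q

  data _HasDegree≤_ {N : ℕ} : Polynomialℚ N → ℕ → Set where
    []  : ∀ {d} → [] HasDegree≤ d
    _∷_ : ∀ {d c m p} → length m ≤ d → p HasDegree≤ d → ((c , m) ∷ p) HasDegree≤ d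

  degree-real : ∀ {N d} {p : Polynomialℚ N} → p HasDegree≤ d → degree (real p) ≤ d
  degree-real []          = z≤n
  degree-real (m≤d ∷ p≤d) = ℕP.⊔-lub m≤d (degree-real p≤d)

  module _ {N : ℕ} where

    private variable
      a b d : ℕ
      p q : Polynomialℚ N

    weaken : a ≤ b → p HasDegree≤ a → p HasDegree≤ b
    weaken a≤b []          = []
    weaken a≤b (m≤a ∷ p≤a) = ℕP.≤-trans m≤a a≤b ∷ weaken a≤b p≤a

    degree-++ : p HasDegree≤ d → q HasDegree≤ d → (p ++ q) HasDegree≤ d
    degree-++ []          q≤d = q≤d
    degree-++ (m≤d ∷ p≤d) q≤d = m≤d ∷ degree-++ p≤d q≤d

    degree-mulTerm : ∀ c m → length m ≤ a → q HasDegree≤ b → mulTerm (c , m) q HasDegree≤ (a ℕ.+ b)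
    degree-mulTerm c m m≤a []           = []
    degree-mulTerm c m m≤a (m′≤b ∷ q≤b) =
      ℕP.≤-trans (ℕP.≤-reflexive (length-++ m)) (ℕP.+-mono-≤ m≤a m′≤b) ∷ degree-mulTerm c m m≤a q≤b

    degree-mul : p HasDegree≤ a → q HasDegree≤ b → mul p q HasDegree≤ (a ℕ.+ b)
    degree-mul []          q≤b = []
    degree-mul {p = (c , m) ∷ _} (m≤a ∷ p≤a) q≤b = degree-++ (degree-mulTerm c m m≤a q≤b) (degree-mul p≤a q≤b)

  module _ {N : ℕ} (z : Vec Bool N) where

    ⟦++⟧ᴹ : ∀ m m′ → ⟦ z ⟧ᴹ (m ++ m′) ≡ ⟦ z ⟧ᴹ m * ⟦ z ⟧ᴹ m′
    ⟦++⟧ᴹ []      m′ = sym (ℚP.*-identityˡ _)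
    ⟦++⟧ᴹ (v ∷ m) m′ = trans (cong (bitℚ (lookup z v) *_) (⟦++⟧ᴹ m m′))
      (sym (ℚP.*-assoc (bitℚ (lookup z v)) _ _))

    ⟦++⟧ : ∀ p q → ⟦ z ⟧ (p ++ q) ≡ ⟦ z ⟧ p + ⟦ z ⟧ q
    ⟦++⟧ []            q = sym (ℚP.+-identityˡ _)
    ⟦++⟧ ((c , m) ∷ p) q = trans (cong (λ w → c * ⟦ z ⟧ᴹ m + w) (⟦++⟧ p q))
      (sym (ℚP.+-assoc (c * ⟦ z ⟧ᴹ m) _ _))

    ⟦mulTerm⟧ : ∀ c m q → ⟦ z ⟧ (mulTerm (c , m) q) ≡ (c * ⟦ z ⟧ᴹ m) * ⟦ z ⟧ q
    ⟦mulTerm⟧ c m []              = sym (ℚP.*-zeroʳ (c * ⟦ z ⟧ᴹ m))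
    ⟦mulTerm⟧ c m ((c′ , m′) ∷ q) = trans
      (cong₂ (λ u v → c * c′ * u + v) (⟦++⟧ᴹ m m′) (⟦mulTerm⟧ c m q))
      (solve 5 (λ a b e f g → (a :* b) :* (e :* f) :+ (a :* e) :* g := (a :* e) :* (b :* f :+ g)) refl
        c c′ (⟦ z ⟧ᴹ m) (⟦ z ⟧ᴹ m′) (⟦ z ⟧ q))

    ⟦mul⟧ : ∀ p q → ⟦ z ⟧ (mul p q) ≡ ⟦ z ⟧ p * ⟦ z ⟧ q
    ⟦mul⟧ []            q = sym (ℚP.*-zeroˡ (⟦ z ⟧ q))
    ⟦mul⟧ ((c , m) ∷ p) q = trans (⟦++⟧ (mulTerm (c , m) q) (mul p q))
      (trans (cong₂ _+_ (⟦mulTerm⟧ c m q) (⟦mul⟧ p q))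
        (sym (ℚP.*-distribʳ-+ (⟦ z ⟧ q) (c * ⟦ z ⟧ᴹ m) (⟦ z ⟧ p))))

  -- Only agreement on Boolean points is demanded, so a function on the cube is handled through its
  -- values and the witnessing polynomial stays in the background.
  record Degree≤ {N} (d : ℕ) (f : Vec Bool N → ℚ) : Set where
    field
      poly    : Polynomialℚ N
      bound   : poly HasDegree≤ d
      correct : ∀ z → ⟦ z ⟧ poly ≡ f z

  open Degree≤

  module _ {N : ℕ} where

    private variable
      a b d : ℕ
      f g : Vec Bool N → ℚ

    weakenᴾ : a ≤ b → Degree≤ a f → Degree≤ b f
    weakenᴾ a≤b F = record { poly = poly F ; bound = weaken a≤b (bound F) ; correct = correct F }

    extᴾ : (∀ z → f z ≡ g z) → Degree≤ d f → Degree≤ d g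
    extᴾ f≗g F = record { poly = poly F ; bound = bound F ; correct = λ z → trans (correct F z) (f≗g z) }

    constᴾ : ∀ q → Degree≤ d (λ (_ : Vec Bool N) → q)
    constᴾ q = record
      { poly    = (q , []) ∷ []
      ; bound   = z≤n ∷ []
      ; correct = λ _ → trans (ℚP.+-identityʳ _) (ℚP.*-identityʳ q)
      }

    infixl 6 _+ᴾ_
    infixl 7 _*ᴾ_

    _+ᴾ_ : Degree≤ d f → Degree≤ d g → Degree≤ d (λ z → f z + g z)
    F +ᴾ G = record
      { poly    = poly F ++ poly G
      ; bound   = degree-++ (bound F) (bound G)
      ; correct = λ z → trans (⟦++⟧ z (poly F) (poly G)) (cong₂ _+_ (correct F z) (correct G z))
      }

    _*ᴾ_ : Degree≤ a f → Degree≤ b g → Degree≤ (a ℕ.+ b) (λ z → f z * g z)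
    F *ᴾ G = record
      { poly    = mul (poly F) (poly G)
      ; bound   = degree-mul (bound F) (bound G)
      ; correct = λ z → trans (⟦mul⟧ z (poly F) (poly G)) (cong₂ _*_ (correct F z) (correct G z))
      }

    varᴾ : ∀ v → Degree≤ 1 (λ (z : Vec Bool N) → bitℚ (lookup z v))
    varᴾ v = record
      { poly    = (1ℚ , v ∷ []) ∷ []
      ; bound   = s≤s z≤n ∷ []
      ; correct = λ z → trans (ℚP.+-identityʳ _) (trans (ℚP.*-identityˡ _) (ℚP.*-identityʳ _))
      }

  -- Chebyshev polynomials

  -- (Tₑ(x) , Uₑ₋₁(x))
  chebyshev : ℕ → ℚ → ℚ × ℚ
  chebyshev zero    x = 1ℚ , 0ℚ
  chebyshev (suc e) x = let (t , u) = chebyshev e x in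
    x * t + (x * x - 1ℚ) * u , t + x * u

  T U : ℕ → ℚ → ℚ
  T e x = proj₁ (chebyshev e x)
  U e x = proj₂ (chebyshev e x)

  -- `T` and `U` are the components of the e-th power of x + √(x² - 1), an element of norm 1. Norms
  -- are multiplicative, which gives T² - (x² - 1)U² = 1; the induction checks this without square
  -- roots.
  pell : ∀ e x → T e x * T e x ≡ 1ℚ + (x * x - 1ℚ) * (U e x * U e x)
  pell zero    x = sym (trans (cong (λ q → 1ℚ + q) (ℚP.*-zeroʳ (x * x - 1ℚ))) (ℚP.+-identityʳ 1ℚ))
  pell (suc e) x = begin
    t′ * t′
      ≡⟨ solve 4 (λ x y t u → (x :* t :+ y :* u) :* (x :* t :+ y :* u)
           := (x :* x) :* (t :* t) :+ (con 1ℚ :+ con 1ℚ) :* (x :* (t :* (y :* u))) :+ y :* (y :* (u :* u)))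
           refl x y t u ⟩
    (x * x) * (t * t) + (1ℚ + 1ℚ) * (x * (t * (y * u))) + y * (y * (u * u))
      -- The induction hypothesis trades `y * (u * u)` for `t * t - 1ℚ`; what remains is a ring
      -- identity once `y` is expanded in `x`. The trade is undone afterwards on the other
      -- occurrence.
      ≡⟨ cong (λ q → (x * x) * (t * t) + (1ℚ + 1ℚ) * (x * (t * (y * u))) + y * q) yuu ⟩
    (x * x) * (t * t) + (1ℚ + 1ℚ) * (x * (t * (y * u))) + y * (t * t - 1ℚ)
      ≡⟨ solve 3 (λ x t u → let y = x :* x :- con 1ℚ in
           (x :* x) :* (t :* t) :+ (con 1ℚ :+ con 1ℚ) :* (x :* (t :* (y :* u))) :+ y :* (t :* t :- con 1ℚ)
           := con 1ℚ :+ (y :* (t :* t :+ (con 1ℚ :+ con 1ℚ) :* (x :* (t :* u)))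
                        :+ (x :* x) :* (t :* t :- con 1ℚ)))
           refl x t u ⟩
    1ℚ + (y * (t * t + (1ℚ + 1ℚ) * (x * (t * u))) + (x * x) * (t * t - 1ℚ))
      ≡⟨ cong (λ q → 1ℚ + (y * (t * t + (1ℚ + 1ℚ) * (x * (t * u))) + (x * x) * q)) (sym yuu) ⟩
    1ℚ + (y * (t * t + (1ℚ + 1ℚ) * (x * (t * u))) + (x * x) * (y * (u * u)))
      ≡⟨ solve 4 (λ x y t u →
           con 1ℚ :+ (y :* (t :* t :+ (con 1ℚ :+ con 1ℚ) :* (x :* (t :* u))) :+ (x :* x) :* (y :* (u :* u)))
           := con 1ℚ :+ y :* ((t :+ x :* u) :* (t :+ x :* u))) refl x y t u ⟩
    1ℚ + y * (u′ * u′) ∎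
    where
    open ≡-Reasoning
    t = T e x
    u = U e x
    t′ = T (suc e) x
    u′ = U (suc e) x
    y = x * x - 1ℚ
    yuu : y * (u * u) ≡ t * t - 1ℚ
    yuu = trans (solve 1 (λ q → q := (con 1ℚ :+ q) :- con 1ℚ) refl (y * (u * u)))
      (cong (_- 1ℚ) (sym (pell e x)))

  module _ {p : ℚ} where

    *-nonNeg : ∀ {q} → 0ℚ ℚ.≤ p → 0ℚ ℚ.≤ q → 0ℚ ℚ.≤ p * q
    *-nonNeg {q} 0≤p 0≤q = ℚP.≤-trans (ℚP.≤-reflexive (sym (ℚP.*-zeroʳ p)))
      (ℚP.*-monoˡ-≤-nonNeg p {{ℚ.nonNegative 0≤p}} 0≤q)

    square-nonNeg : 0ℚ ℚ.≤ p * p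
    square-nonNeg with ℚP.≤-total 0ℚ p
    ... | inj₁ 0≤p = *-nonNeg 0≤p 0≤p
    ... | inj₂ p≤0 = ℚP.≤-trans (ℚP.≤-reflexive (sym (ℚP.*-zeroʳ p)))
          (ℚP.*-monoˡ-≤-nonPos p {{ℚ.nonPositive p≤0}} p≤0)

  p*p≤1⇒∣p∣≤1 : ∀ p → p * p ℚ.≤ 1ℚ → ℚ.∣ p ∣ ℚ.≤ 1ℚ
  p*p≤1⇒∣p∣≤1 p pp≤1 with ℚP.≤-total ℚ.∣ p ∣ 1ℚ
  ... | inj₁ h = h
  ... | inj₂ 1≤∣p∣ = ℚP.≤-trans
    (ℚP.≤-trans (ℚP.≤-reflexive (sym (ℚP.*-identityʳ ℚ.∣ p ∣)))
      (ℚP.*-monoˡ-≤-nonNeg ℚ.∣ p ∣ {{ℚP.∣-∣-nonNeg p}} 1≤∣p∣))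
    (ℚP.≤-trans (ℚP.≤-reflexive (trans (sym (ℚP.∣p*q∣≡∣p∣*∣q∣ p p)) (ℚP.0≤p⇒∣p∣≡p (square-nonNeg {p})))) pp≤1)

  0≤q-p : ∀ {p q} → p ℚ.≤ q → 0ℚ ℚ.≤ q - p
  0≤q-p {p} p≤q = ℚP.≤-trans (ℚP.≤-reflexive (sym (ℚP.+-inverseʳ p))) (ℚP.+-monoˡ-≤ (- p) p≤q)

  0≤q-p⇒p≤q : ∀ {p q} → 0ℚ ℚ.≤ q - p → p ℚ.≤ q
  0≤q-p⇒p≤q {p} {q} h = ℚP.≤-trans (ℚP.≤-reflexive (sym (ℚP.+-identityˡ p)))
    (ℚP.≤-trans (ℚP.+-monoˡ-≤ p h)
      (ℚP.≤-reflexive (solve 2 (λ p q → (q :- p) :+ p := q) refl p q)))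

  -- By `pell`, 1 - T² = (1 - x)(1 + x)U², a product of nonnegative factors. This takes the place of
  -- the trigonometric argument.
  ∣T∣≤1 : ∀ e {x} → 0ℚ ℚ.≤ x → x ℚ.≤ 1ℚ → ℚ.∣ T e x ∣ ℚ.≤ 1ℚ
  ∣T∣≤1 e {x} 0≤x x≤1 = p*p≤1⇒∣p∣≤1 (T e x) (0≤q-p⇒p≤q (ℚP.≤-trans
    (*-nonNeg (*-nonNeg (0≤q-p x≤1) 0≤1+x) (square-nonNeg {U e x}))
    (ℚP.≤-reflexive (trans
      (solve 2 (λ x w → ((con 1ℚ :- x) :* (con 1ℚ :+ x)) :* w
         := con 1ℚ :- (con 1ℚ :+ (x :* x :- con 1ℚ) :* w)) refl x (U e x * U e x))
      (cong (λ q → 1ℚ - q) (sym (pell e x)))))))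
    where
    0≤1+x : 0ℚ ℚ.≤ 1ℚ + x
    0≤1+x = ℚP.≤-trans 0≤x (ℚP.≤-trans (ℚP.≤-reflexive (sym (ℚP.+-identityˡ x)))
      (ℚP.+-monoˡ-≤ x (ℚP.nonNegative⁻¹ 1ℚ)))

  -- Iterated addition of `1ℚ`: it unfolds on successors, and the library laws for multiples make it
  -- a semiring homomorphism.
  ι : ℕ → ℚ
  ι n = n · 1ℚ

  ι-nonNeg : ∀ n → 0ℚ ℚ.≤ ι n
  ι-nonNeg zero    = ℚP.≤-refl
  ι-nonNeg (suc n) = ℚP.+-mono-≤ (ℚP.nonNegative⁻¹ 1ℚ) (ι-nonNeg n)

  ι-mono-≤ : ∀ {m n} → m ≤ n → ι m ℚ.≤ ι n
  ι-mono-≤ {n = n} z≤n = ι-nonNeg n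
  ι-mono-≤ (s≤s m≤n)   = ℚP.+-monoʳ-≤ 1ℚ (ι-mono-≤ m≤n)

  -- The two bounds need each other: with x = 1 + c, one step of the recurrence for `T` gains (2c +
  -- c²)U, and U ≥ e turns this into the growth from e² to (e + 1)².
  chebyshev-grows : ∀ e {c} → 0ℚ ℚ.≤ c →
                    1ℚ + ι e * ι e * c ℚ.≤ T e (1ℚ + c) × ι e ℚ.≤ U e (1ℚ + c)
  chebyshev-grows zero    {c} 0≤c =
    ℚP.≤-reflexive (solve 1 (λ c → con 1ℚ :+ con 0ℚ :* con 0ℚ :* c := con 1ℚ) refl c) ,
    ℚP.≤-refl
  chebyshev-grows (suc e) {c} 0≤c with T e (1ℚ + c) | U e (1ℚ + c) | chebyshev-grows e 0≤c
  ... | t | u | t≥ , u≥ =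
    -- The gap is written as a sum of nonnegative terms: the two induction hypotheses weighted by x
    -- and x² - 1, and the leftover c²i² + c²i with i = `ι e`.
    0≤q-p⇒p≤q (ℚP.≤-trans
      (ℚP.+-mono-≤ (ℚP.+-mono-≤ (*-nonNeg 0≤1+c (0≤q-p t≥)) (*-nonNeg 0≤2c+cc (0≤q-p u≥)))
                   (ℚP.+-mono-≤ (*-nonNeg (*-nonNeg 0≤c 0≤c) (*-nonNeg (ι-nonNeg e) (ι-nonNeg e)))
                                (*-nonNeg (*-nonNeg 0≤c 0≤c) (ι-nonNeg e))))
      (ℚP.≤-reflexive (solve 4 (λ c t u i →
        let x = con 1ℚ :+ c ; j = con 1ℚ :+ i in
        ((x :* (t :- (con 1ℚ :+ i :* i :* c))) :+ (c :+ c :+ c :* c) :* (u :- i))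
          :+ ((c :* c) :* (i :* i) :+ (c :* c) :* i)
        := (x :* t :+ (x :* x :- con 1ℚ) :* u) :- (con 1ℚ :+ j :* j :* c)) refl c t u (ι e)))) ,
    0≤q-p⇒p≤q (ℚP.≤-trans
      (ℚP.+-mono-≤ (ℚP.+-mono-≤ (0≤q-p t≥) (*-nonNeg (*-nonNeg (ι-nonNeg e) (ι-nonNeg e)) 0≤c))
                   (ℚP.+-mono-≤ (0≤q-p u≥) (*-nonNeg 0≤c (ℚP.≤-trans (ι-nonNeg e) u≥))))
      (ℚP.≤-reflexive (solve 4 (λ c t u i →
        ((t :- (con 1ℚ :+ i :* i :* c)) :+ i :* i :* c) :+ ((u :- i) :+ c :* u)
        := (t :+ (con 1ℚ :+ c) :* u) :- (con 1ℚ :+ i)) refl c t u (ι e))))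
    where
    0≤1+c : 0ℚ ℚ.≤ 1ℚ + c
    0≤1+c = ℚP.+-mono-≤ (ℚP.nonNegative⁻¹ 1ℚ) 0≤c
    0≤2c+cc : 0ℚ ℚ.≤ c + c + c * c
    0≤2c+cc = ℚP.+-mono-≤ (ℚP.+-mono-≤ 0≤c 0≤c) (*-nonNeg 0≤c 0≤c)

  -- Each step is charged 2d, the degree of the factor x² - 1, so that one budget serves both `T`
  -- and `U`. Compared with the true degree e·d of `T` this loses only a factor 2.
  chebyshevᴾ : ∀ {N d} {f : Vec Bool N → ℚ} → Degree≤ d f → ∀ e →
               Degree≤ (e ℕ.* (d ℕ.+ d)) (λ z → T e (f z)) × Degree≤ (e ℕ.* (d ℕ.+ d)) (λ z → U e (f z))
  chebyshevᴾ         F zero    = constᴾ 1ℚ , constᴾ 0ℚ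
  chebyshevᴾ {d = d} F (suc e) = let (Tᴾ , Uᴾ) = chebyshevᴾ F e in
    weakenᴾ (ℕP.+-monoˡ-≤ _ (ℕP.m≤m+n d d)) (F *ᴾ Tᴾ) +ᴾ (F *ᴾ F +ᴾ constᴾ (- 1ℚ)) *ᴾ Uᴾ ,
    weakenᴾ (ℕP.m≤n+m _ (d ℕ.+ d)) Tᴾ +ᴾ weakenᴾ (ℕP.+-monoˡ-≤ _ (ℕP.m≤m+n d d)) (F *ᴾ Uᴾ)

  -- Approximating the indicator of zero

  ⅓ : ℚ
  ⅓ = + 1 ℚ./ 3

  record Approximationℚ {N} (g : BooleanFunction N) (d : ℕ) : Set where
    field
      approximant : Vec Bool N → ℚ
      hasDegree   : Degree≤ d approximant
      close       : ∀ z → ℚ.∣ approximant z - bitℚ (g z) ∣ ℚ.≤ ⅓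

  approxDegree≤ : ∀ {N d} {g : BooleanFunction N} → Approximationℚ g d → ApproxDegree≤ g d
  approxDegree≤ {g = g} h = real (poly F) , degree-real (bound F) , λ z ε 0<ε → 0 , λ k _ →
    ℚP.≤-trans
      (ℚP.≤-reflexive (cong₂ (λ u v → ℚ.∣ u - v ∣)
        (trans (seq-eval z (poly F) k) (correct F z)) (seq-bitᴿ (g z) k)))
      (ℚP.≤-trans (Approximationℚ.close h z)
        (ℚP.≤-trans (ℚP.≤-reflexive (sym (ℚP.+-identityʳ ⅓))) (ℚP.+-monoʳ-≤ ⅓ (ℚP.<⇒≤ 0<ε))))
    where
    F = Approximationℚ.hasDegree h

  -- With c = 1/B the point 1 + c - c v lies in [0,1] for 1 ≤ v ≤ B, where ∣Tₑ∣ ≤ 1,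
  -- while v = 0 gives 1 + c, where Tₑ ≥ 1 + e²/B ≥ 3.
  module _ {B e : ℕ} .{{_ : NonZero B}} (2B≤ee : 2 ℕ.* B ≤ e ℕ.* e) where

    private
      instance
        B-pos : Positive (ι B)
        B-pos = ℚ.positive (ℚP.<-≤-trans (ℚP.positive⁻¹ 1ℚ)
          (ℚP.≤-trans (ℚP.≤-reflexive (sym (ℚP.+-identityʳ 1ℚ))) (ι-mono-≤ (ℕ.>-nonZero⁻¹ B))))
        B-nonZero : ℚ.NonZero (ι B)
        B-nonZero = ℚP.pos⇒nonZero (ι B)
      c : ℚ
      c = 1/ ι B
      0≤c : 0ℚ ℚ.≤ c
      0≤c = ℚP.<⇒≤ (ℚP.positive⁻¹ c {{ℚP.1/pos⇒pos (ι B)}})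
      Bc≡1 : ι B * c ≡ 1ℚ
      Bc≡1 = ℚP.*-inverseʳ (ι B)
      t : ℚ
      t = T e (1ℚ + c)
      3≤t : 1ℚ + (1ℚ + 1ℚ) ℚ.≤ t
      3≤t = ℚP.≤-trans (ℚP.+-monoʳ-≤ 1ℚ (begin
        1ℚ + 1ℚ                 ≡⟨ cong₂ _+_ (sym Bc≡1) (sym Bc≡1) ⟩
        ι B * c + ι B * c       ≡⟨ ℚP.*-distribʳ-+ c (ι B) (ι B) ⟨
        (ι B + ι B) * c         ≡⟨ cong (_* c) (×-homo-+ 1ℚ B B) ⟨
        ι (B ℕ.+ B) * c         ≡⟨ cong (λ k → ι (B ℕ.+ k) * c) (ℕP.+-identityʳ B) ⟨
        ι (2 ℕ.* B) * c         ≤⟨ ℚP.*-monoʳ-≤-nonNeg c {{ℚ.nonNegative 0≤c}} (ι-mono-≤ 2B≤ee) ⟩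
        ι (e ℕ.* e) * c         ≡⟨ cong (_* c) (×1-homo-* e e) ⟩
        ι e * ι e * c           ∎)) (proj₁ (chebyshev-grows e 0≤c))
        where open ℚP.≤-Reasoning
      instance
        t-pos : Positive t
        t-pos = ℚ.positive (ℚP.<-≤-trans (ℚP.positive⁻¹ (1ℚ + (1ℚ + 1ℚ))) 3≤t)
        t-nonZero : ℚ.NonZero t
        t-nonZero = ℚP.pos⇒nonZero t
      s : ℚ
      s = 1/ t
      0≤s : 0ℚ ℚ.≤ s
      0≤s = ℚP.<⇒≤ (ℚP.positive⁻¹ s {{ℚP.1/pos⇒pos t}})
      s≤⅓ : s ℚ.≤ ⅓
      s≤⅓ = begin
        s
          ≡⟨ solve 1 (λ s → s := con ⅓ :* (s :* (con 1ℚ :+ (con 1ℚ :+ con 1ℚ)))) refl s ⟩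
        ⅓ * (s * (1ℚ + (1ℚ + 1ℚ)))
          ≤⟨ ℚP.*-monoˡ-≤-nonNeg ⅓ (ℚP.*-monoˡ-≤-nonNeg s {{ℚ.nonNegative 0≤s}} 3≤t) ⟩
        ⅓ * (s * t)
          ≡⟨ cong (⅓ *_) (ℚP.*-inverseˡ t) ⟩
        ⅓ * 1ℚ
          ≡⟨ ℚP.*-identityʳ ⅓ ⟩
        ⅓ ∎
        where open ℚP.≤-Reasoning

      point : ℕ → ℚ
      point v = (1ℚ + c) + (- c) * ι v

    -- Dividing by the value `t` at v = 0 makes the approximation exact there, and t ≥ 3 shrinks the
    -- range [-1,1] to error at most 1/3 elsewhere.
    isZeroApprox : ℕ → ℚ
    isZeroApprox v = s * T e (point v)

    isZeroApprox-0 : isZeroApprox 0 ≡ 1ℚ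
    isZeroApprox-0 = trans
      (cong (λ x → s * T e x) (trans (cong (λ q → (1ℚ + c) + q) (ℚP.*-zeroʳ (- c))) (ℚP.+-identityʳ (1ℚ + c))))
      (ℚP.*-inverseˡ t)

    isZeroApprox-suc : ∀ v → suc v ≤ B → ℚ.∣ isZeroApprox (suc v) ∣ ℚ.≤ ⅓
    isZeroApprox-suc v v<B = begin
      ℚ.∣ s * T e x ∣          ≡⟨ ℚP.∣p*q∣≡∣p∣*∣q∣ s (T e x) ⟩
      ℚ.∣ s ∣ * ℚ.∣ T e x ∣    ≡⟨ cong (_* ℚ.∣ T e x ∣) (ℚP.0≤p⇒∣p∣≡p 0≤s) ⟩
      s * ℚ.∣ T e x ∣          ≤⟨ ℚP.*-monoˡ-≤-nonNeg s {{ℚ.nonNegative 0≤s}} (∣T∣≤1 e 0≤x x≤1) ⟩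
      s * 1ℚ                   ≡⟨ ℚP.*-identityʳ s ⟩
      s                        ≤⟨ s≤⅓ ⟩
      ⅓                        ∎
      where
      open ℚP.≤-Reasoning
      x : ℚ
      x = point (suc v)
      0≤x : 0ℚ ℚ.≤ x
      -- Since B·c = 1, the point for v equals c + (B - v)c, and v ≤ B.
      0≤x = ℚP.≤-trans
        (ℚP.+-mono-≤ 0≤c (*-nonNeg (0≤q-p (ι-mono-≤ v<B)) 0≤c))
        (ℚP.≤-reflexive (trans
          (solve 3 (λ c b v → c :+ (b :- v) :* c := (b :* c :+ c) :- c :* v) refl c (ι B) (ι (suc v)))
          (trans (cong (λ q → (q + c) - c * ι (suc v)) Bc≡1)
            (cong (λ q → (1ℚ + c) + q) (ℚP.neg-distribˡ-* c (ι (suc v)))))))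
      x≤1 : x ℚ.≤ 1ℚ
      -- The point for `suc v` falls short of 1 by exactly c·v.
      x≤1 = 0≤q-p⇒p≤q (ℚP.≤-trans (*-nonNeg 0≤c (ι-nonNeg v)) (ℚP.≤-reflexive
        (solve 2 (λ c v → c :* v := con 1ℚ :- ((con 1ℚ :+ c) :+ (:- c) :* (con 1ℚ :+ v))) refl c (ι v))))

    isZero-approx : ∀ {N d} {g : BooleanFunction N} {V : Vec Bool N → ℕ} →
                    Degree≤ d (λ z → ι (V z)) → (∀ z → V z ≤ B) →
                    (∀ z → V z ≡ 0 → g z ≡ true) → (∀ z → V z ≢ 0 → g z ≡ false) →
                    Approximationℚ g (e ℕ.* (d ℕ.+ d))
    isZero-approx {V = V} F V≤B g-true g-false = record
      -- Constants are given degree 0, so `0 + d` computes to `d` and neither the affine change of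
      -- variable nor the scaling costs any degree.
      { hasDegree = constᴾ {d = 0} s *ᴾ proj₁ (chebyshevᴾ (constᴾ (1ℚ + c) +ᴾ constᴾ {d = 0} (- c) *ᴾ F) e)
      ; close     = λ z → isZero (V z) (V≤B z) (g-true z) (g-false z)
      }
      where
      isZero : ∀ v {b} → v ≤ B → (v ≡ 0 → b ≡ true) → (v ≢ 0 → b ≡ false) →
               ℚ.∣ isZeroApprox v - bitℚ b ∣ ℚ.≤ ⅓
      isZero zero    _   yes! _   = ℚP.≤-trans
        (ℚP.≤-reflexive (cong₂ (λ p b → ℚ.∣ p - bitℚ b ∣) isZeroApprox-0 (yes! refl)))
        (ℚP.nonNegative⁻¹ ⅓)
      isZero (suc v) v<B _    no! = ℚP.≤-trans
        (ℚP.≤-reflexive (trans (cong (λ b → ℚ.∣ isZeroApprox (suc v) - bitℚ b ∣) (no! λ ()))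
          (cong ℚ.∣_∣ (ℚP.+-identityʳ (isZeroApprox (suc v))))))
        (isZeroApprox-suc v v<B)

open import Data.Nat using (_+_; _*_; _∸_; _^_; _/_; _%_)

-- Query complexity

-- g can be computed by adaptively querying d bits: after d queries, any
-- continuation F may depend on the value of g.
record Depth≤ {N} {A : Set} (d : ℕ) (g : Vec Bool N → A) : Set where
  constructor depth
  field
    continue : ∀ {e} (F : A → Vec Bool N → ℚ) →
               (∀ a → Degree≤ e (F a)) → Degree≤ (d + e) (λ z → F (g z) z)

open Depth≤

module _ {N : ℕ} where

  private variable
    A B C : Set
    d e : ℕ
    g h : Vec Bool N → A

  depth-weaken : d ≤ e → Depth≤ d g → Depth≤ e g
  depth-weaken d≤e gᴰ = depth λ F Fᴾ → weakenᴾ (ℕP.+-monoˡ-≤ _ d≤e) (continue gᴰ F Fᴾ)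

  depth-const : (a : A) → Depth≤ {N} d (λ _ → a)
  depth-const a = depth-weaken z≤n (depth λ F Fᴾ → Fᴾ a)

  -- A branch on the bit b is b·F(true) + (1 - b)·F(false). Both branches share the degree budget,
  -- so one query adds one degree.
  depth-lookup : ∀ v → Depth≤ {N} 1 (λ z → lookup z v)
  depth-lookup v = depth λ F Fᴾ → extᴾ (λ z → select (lookup z v) (λ b → F b z))
    (varᴾ v *ᴾ Fᴾ true +ᴾ (constᴾ 1ℚ +ᴾ constᴾ {d = 0} (ℚ.- 1ℚ) *ᴾ varᴾ v) *ᴾ Fᴾ false)
    where
    select : ∀ b (G : Bool → ℚ) →
             bitℚ b ℚ.* G true ℚ.+ (1ℚ ℚ.+ ℚ.- 1ℚ ℚ.* bitℚ b) ℚ.* G false ≡ G b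
    select true  G = solve 2 (λ p q → con 1ℚ :* p :+ (con 1ℚ :+ :- con 1ℚ :* con 1ℚ) :* q := p)
                             refl (G true) (G false)
    select false G = solve 2 (λ p q → con 0ℚ :* p :+ (con 1ℚ :+ :- con 1ℚ :* con 0ℚ) :* q := q)
                             refl (G true) (G false)

  -- Running `h a` with the final continuation is itself a continuation for `g`, so adaptive
  -- composition adds the depths.
  depth-bind : {h : A → Vec Bool N → B} →
               Depth≤ d g → (∀ a → Depth≤ e (h a)) → Depth≤ (d + e) (λ z → h (g z) z)
  depth-bind {d = d} {e = e} {h = h} gᴰ hᴰ = depth λ {k} F Fᴾ →
    weakenᴾ (ℕP.≤-reflexive (sym (ℕP.+-assoc d e k)))
      (continue gᴰ (λ a z → F (h a z) z) (λ a → continue (hᴰ a) F Fᴾ))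

  depth-ext : (∀ z → g z ≡ h z) → Depth≤ d g → Depth≤ d h
  depth-ext g≗h gᴰ = depth λ F Fᴾ → extᴾ (λ z → cong (λ a → F a z) (g≗h z)) (continue gᴰ F Fᴾ)

  depth-map : (f : A → B) → Depth≤ d g → Depth≤ d (λ z → f (g z))
  depth-map f gᴰ = depth λ F Fᴾ → continue gᴰ (F ∘ f) (Fᴾ ∘ f)

  depth-zipWith : (f : A → B → C) → Depth≤ d g → Depth≤ e h → Depth≤ (d + e) (λ z → f (g z) (h z))
  depth-zipWith f gᴰ hᴰ = depth-bind gᴰ λ a → depth-map (f a) hᴰ

  depth-list : (f : A → Vec Bool N → B) → (∀ a → Depth≤ d (f a)) →
               ∀ xs → Depth≤ (length xs * d) (λ z → map (λ a → f a z) xs)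
  depth-list f fᴰ []       = depth-const []
  depth-list f fᴰ (x ∷ xs) = depth-zipWith _∷_ (fᴰ x) (depth-list f fᴰ xs)

  depth-tabulate : ∀ {n} (f : Fin n → Vec Bool N → B) → (∀ i → Depth≤ d (f i)) →
                   Depth≤ (n * d) (λ z → tabulate (λ i → f i z))
  depth-tabulate {n = zero}  f fᴰ = depth-const []
  depth-tabulate {n = suc n} f fᴰ = depth-zipWith _∷_ (fᴰ zero) (depth-tabulate (f ∘ suc) (fᴰ ∘ suc))

  Depth⇒Degree : {f : Vec Bool N → ℕ} → Depth≤ d f → Degree≤ d (λ z → ι (f z))
  Depth⇒Degree {d = d} fᴰ =
    weakenᴾ (ℕP.≤-reflexive (ℕP.+-identityʳ d)) (continue fᴰ (λ k _ → ι k) (λ k → constᴾ (ι k)))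

  degree-+ : (f g : Vec Bool N → ℕ) → Degree≤ d (λ z → ι (f z)) → Degree≤ d (λ z → ι (g z)) →
             Degree≤ d (λ z → ι (f z + g z))
  degree-+ f g F G = extᴾ (λ z → sym (×-homo-+ 1ℚ (f z) (g z))) (F +ᴾ G)

  -- Summands are turned into polynomials before they are added, so the degree is that of a single
  -- summand however long the list. By contrast, `depth-list` pays for every entry.
  degree-sum : (f : A → Vec Bool N → ℕ) → (∀ a → Depth≤ d (f a)) →
               ∀ xs → Degree≤ d (λ z → ι (sum (map (λ a → f a z) xs)))
  degree-sum f fᴰ []       = constᴾ 0ℚ
  degree-sum f fᴰ (x ∷ xs) = degree-+ (f x) (λ z → sum (map (λ a → f a z) xs))
    (Depth⇒Degree (fᴰ x)) (degree-sum f fᴰ xs)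

-- Membership

-- The last test of `mem` with the position as an argument, so that `depth-bind` can branch on the
-- outcome of the search.
memAt : ∀ {n M} → Vec (Fin n) M → Fin n → ℕ → Bool
memAt {M = M} A i p with p ℕP.<? M
... | yes p<M = does (lookup A (fromℕ< p<M) FinP.≟ i)
... | no  _   = false

mem≡memAt : ∀ {n M} (A : Vec (Fin n) M) i → mem A i ≡ memAt A i (search A i M 0 M ℕP.≤-refl)
mem≡memAt {M = M} A i with search A i M 0 M ℕP.≤-refl ℕP.<? M
... | yes _ = refl
... | no  _ = refl

-- A positive answer always comes from comparing an actual entry with `i`, so this holds for
-- unsorted lists as well.
mem⇒lookup : ∀ {n M} (A : Vec (Fin n) M) i → mem A i ≡ true → ∃[ p ] lookup A p ≡ i
mem⇒lookup {M = M} A i h with search A i M 0 M ℕP.≤-refl ℕP.<? M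
... | yes p<M with lookup A (fromℕ< p<M) FinP.≟ i
...   | yes e = _ , e

∣p∪q∣≤∣p∣+∣q∣ : ∀ {n} (p q : Subset n) → ∣ p ∪ q ∣ ≤ ∣ p ∣ + ∣ q ∣
∣p∪q∣≤∣p∣+∣q∣ []          []          = z≤n
∣p∪q∣≤∣p∣+∣q∣ (true  ∷ p) (true  ∷ q) =
  s≤s (ℕP.≤-trans (∣p∪q∣≤∣p∣+∣q∣ p q) (ℕP.+-monoʳ-≤ ∣ p ∣ (ℕP.n≤1+n ∣ q ∣)))
∣p∪q∣≤∣p∣+∣q∣ (true  ∷ p) (false ∷ q) = s≤s (∣p∪q∣≤∣p∣+∣q∣ p q)
∣p∪q∣≤∣p∣+∣q∣ (false ∷ p) (true  ∷ q) =
  ℕP.≤-trans (s≤s (∣p∪q∣≤∣p∣+∣q∣ p q)) (ℕP.≤-reflexive (sym (ℕP.+-suc ∣ p ∣ ∣ q ∣)))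
∣p∪q∣≤∣p∣+∣q∣ (false ∷ p) (false ∷ q) = ∣p∪q∣≤∣p∣+∣q∣ p q

-- Contains everything that `mem` finds, and has at most M members even when the list repeats
-- entries; `r-sparse` is applied to this set.
elements : ∀ {n M} → Vec (Fin n) M → Subset n
elements []      = ⊥
elements (a ∷ A) = ⁅ a ⁆ ∪ elements A

∣elements∣≤ : ∀ {n M} (A : Vec (Fin n) M) → ∣ elements A ∣ ≤ M
∣elements∣≤ {n} []  = ℕP.≤-reflexive (∣⊥∣≡0 n)
∣elements∣≤ (a ∷ A) = ℕP.≤-trans (∣p∪q∣≤∣p∣+∣q∣ ⁅ a ⁆ (elements A))
  (ℕP.+-mono-≤ (ℕP.≤-reflexive (∣⁅x⁆∣≡1 a)) (∣elements∣≤ A))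

lookup∈elements : ∀ {n M} (A : Vec (Fin n) M) p → lookup A p ∈ elements A
lookup∈elements (a ∷ A) zero    = x∈p∪q⁺ (inj₁ (x∈⁅x⁆ a))
lookup∈elements (a ∷ A) (suc p) = x∈p∪q⁺ (inj₂ (lookup∈elements A p))

mem⇒∈ : ∀ {n M} (A : Vec (Fin n) M) i → mem A i ≡ true → i ∈ elements A
mem⇒∈ A i h with mem⇒lookup A i h
... | p , refl = lookup∈elements A p

midpoint< : ∀ {lo hi} → lo < hi → (lo + hi) / 2 < hi
midpoint< {lo} {hi} lo<hi = m<n*o⇒m/o<n (subst (lo + hi <_)
  (trans (cong (hi +_) (sym (ℕP.+-identityʳ hi))) (ℕP.*-comm 2 hi)) (ℕP.+-monoˡ-< hi lo<hi))

-- The midpoint q satisfies lo + hi - 1 ≤ 2q ≤ lo + hi, so either half of an interval shorter than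
-- 2m is shorter than m.
halve : ∀ {lo hi} m → lo < hi → hi ∸ lo < 2 * m →
        hi ∸ suc ((lo + hi) / 2) < m × (lo + hi) / 2 ∸ lo < m
halve {lo} {hi} zero    lo<hi ()
halve {lo} {hi} m@(suc _) lo<hi h =
  -- The remainder of the division may add 1; it is absorbed because `hi<lo+2m` is strict.
  ℕP.m<n+o⇒m∸n<o hi (suc q) (s≤s (ℕP.*-cancelˡ-≤ 2 (ℕP.≤-pred (begin-strict
    2 * hi                    ≡⟨ cong (hi +_) (ℕP.+-identityʳ hi) ⟩
    hi + hi                   <⟨ ℕP.+-monoˡ-< hi hi<lo+2m ⟩
    lo + 2 * m + hi           ≡⟨ shuffle₁ lo m hi ⟩
    lo + hi + 2 * m           ≡⟨ cong (_+ 2 * m) (m≡m%n+[m/n]*n (lo + hi) 2) ⟩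
    r + q * 2 + 2 * m         ≤⟨ ℕP.+-monoˡ-≤ (2 * m) (ℕP.+-monoˡ-≤ (q * 2) (ℕP.≤-pred (m%n<n (lo + hi) 2))) ⟩
    1 + q * 2 + 2 * m         ≡⟨ shuffle₂ q m ⟩
    suc (2 * (q + m))         ∎)))) ,
  ℕP.m<n+o⇒m∸n<o q lo (ℕP.*-cancelˡ-< 2 q (lo + m) (begin-strict
    2 * q                     ≡⟨ ℕP.*-comm 2 q ⟩
    q * 2                     ≤⟨ ℕP.m≤n+m (q * 2) r ⟩
    r + q * 2                 ≡⟨ m≡m%n+[m/n]*n (lo + hi) 2 ⟨
    lo + hi                   <⟨ ℕP.+-monoʳ-< lo hi<lo+2m ⟩
    lo + (lo + 2 * m)         ≡⟨ shuffle₃ lo m ⟩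
    2 * (lo + m)              ∎))
  where
  open ℕP.≤-Reasoning
  q = (lo + hi) / 2
  r = (lo + hi) % 2
  hi<lo+2m : hi < lo + 2 * m
  hi<lo+2m = ℕP.≤-<-trans (ℕP.m≤n+m∸n hi lo) (ℕP.+-monoʳ-< lo h)
  shuffle₁ : ∀ lo m hi → lo + 2 * m + hi ≡ lo + hi + 2 * m
  shuffle₁ = solve-∀
  shuffle₂ : ∀ q m → 1 + q * 2 + 2 * m ≡ suc (2 * (q + m))
  shuffle₂ = solve-∀
  shuffle₃ : ∀ lo m → lo + (lo + 2 * m) ≡ 2 * (lo + m)
  shuffle₃ = solve-∀

module _ {N n M w : ℕ} (A : Vec Bool N → Vec (Fin n) M)
         (Aᴰ : ∀ p → Depth≤ w (λ z → lookup (A z) p)) (i : Fin n) where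

  -- The fuel only ensures termination and would give depth M·w. The number of queried entries is
  -- bounded by `k` instead, through the invariant hi - lo < 2^k, which `halve` passes on with k -
  -- 1.
  depth-search : ∀ k fuel lo hi .(hi≤M : hi ≤ M) → hi ∸ lo < 2 ^ k →
                 Depth≤ (k * w) (λ z → search (A z) i fuel lo hi hi≤M)
  depth-search k zero lo hi hi≤M h = depth-const lo
  depth-search k (suc fuel) lo hi hi≤M h with lo ℕP.<? hi
  depth-search k       (suc fuel) lo hi hi≤M h | no _      = depth-const lo
  -- Here hi - lo < 2^0 = 1, so the loop has already exited.
  depth-search zero    (suc fuel) lo hi hi≤M h | yes lo<hi = contradiction (ℕP.m<n⇒0<n∸m lo<hi) (ℕP.<⇒≱ h)
  depth-search (suc k) (suc fuel) lo hi hi≤M h | yes lo<hi =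
    depth-bind {h = λ a → next (does (a FinP.<? i))} (Aᴰ _) λ a → depth-next (does (a FinP.<? i))
    where
    q : ℕ
    q = (lo + hi) / 2
    q<hi : q < hi
    q<hi = midpoint< lo<hi
    next : Bool → Vec Bool N → ℕ
    next b z = if b then search (A z) i fuel (suc q) hi hi≤M
                    else search (A z) i fuel lo q (ℕP.≤-trans (ℕP.<⇒≤ q<hi) hi≤M)
    depth-next : ∀ b → Depth≤ (k * w) (next b)
    depth-next true  = depth-search k fuel (suc q) hi hi≤M (proj₁ (halve (2 ^ k) lo<hi h))
    depth-next false = depth-search k fuel lo q (ℕP.≤-trans (ℕP.<⇒≤ q<hi) hi≤M)
                                    (proj₂ (halve (2 ^ k) lo<hi h))

  depth-mem : ∀ k → M < 2 ^ k → Depth≤ (k * w + w) (λ z → mem (A z) i)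
  depth-mem k M<2^k = depth-ext (λ z → sym (mem≡memAt (A z) i))
    (depth-bind {h = λ p z → memAt (A z) i p} (depth-search k M 0 M ℕP.≤-refl M<2^k) depth-memAt)
    where
    depth-memAt : ∀ p → Depth≤ w (λ z → memAt (A z) i p)
    depth-memAt p with p ℕP.<? M
    ... | yes p<M = depth-map (λ a → does (a FinP.≟ i)) (Aᴰ (fromℕ< p<M))
    ... | no  _   = depth-const false

-- Counting violations

bit≤1 : ∀ b → bit b ≤ 1
bit≤1 true  = ℕP.≤-refl
bit≤1 false = z≤n

bit≢0 : ∀ {b} → bit b ≢ 0 → b ≡ true
bit≢0 {true}  _ = refl
bit≢0 {false} h = contradiction refl h

module _ {A : Set} where

  violations : {P : A → Set} → (∀ a → Dec (P a)) → List A → ℕ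
  violations P? = sum ∘ map (λ a → bit (not (does (P? a))))

  module _ {P : A → Set} (P? : ∀ a → Dec (P a)) where

    violations≤length : ∀ xs → violations P? xs ≤ length xs
    violations≤length []       = z≤n
    violations≤length (x ∷ xs) = ℕP.+-mono-≤ (bit≤1 (not (does (P? x)))) (violations≤length xs)

    violations≡0⇒ : ∀ xs → violations P? xs ≡ 0 → ∀ {a} → a ∈ᴸ xs → P a
    violations≡0⇒ (x ∷ xs) h a∈ with P? x
    violations≡0⇒ (x ∷ xs) h (here refl)  | yes px = px
    violations≡0⇒ (x ∷ xs) h (there a∈)   | yes px = violations≡0⇒ xs h a∈

    violations≡0⇐ : (∀ a → P a) → ∀ xs → violations P? xs ≡ 0
    violations≡0⇐ p []       = refl
    violations≡0⇐ p (x ∷ xs) with P? x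
    ... | yes _  = violations≡0⇐ p xs
    ... | no ¬px = contradiction (p x) ¬px

  -- For `W`, `P?` keeps the pairs off the diagonal and `Q?` the pairs counted by `r-sparse`. A term
  -- outside `Q` vanishes, and any other term is charged to its own place in the second list.
  sum-filter≤ : {P Q : A → Set} (P? : ∀ a → Dec (P a)) (Q? : ∀ a → Dec (Q a)) (f : A → ℕ) →
                (∀ a → f a ≤ 1) → (∀ a → f a ≢ 0 → Q a) →
                ∀ xs → sum (map f (filter P? xs)) ≤ length (filter Q? xs)
  sum-filter≤ P? Q? f f≤1 f⇒Q []       = z≤n
  sum-filter≤ P? Q? f f≤1 f⇒Q (x ∷ xs) with sum-filter≤ P? Q? f f≤1 f⇒Q xs | P? x | Q? x
  ... | ih | no  _ | no  _  = ih
  ... | ih | no  _ | yes _  = ℕP.m≤n⇒m≤1+n ih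
  ... | ih | yes _ | yes _  = ℕP.+-mono-≤ (f≤1 x) ih
  ... | ih | yes _ | no ¬qx with f x ℕP.≟ 0
  ...   | yes fx≡0 = ℕP.≤-trans (ℕP.≤-reflexive (cong (_+ sum (map f (filter P? xs))) fx≡0)) ih
  ...   | no  fx≢0 = contradiction (f⇒Q x fx≢0) ¬qx

  product≤1 : (f : A → ℕ) → (∀ a → f a ≤ 1) → ∀ xs → product (map f xs) ≤ 1
  product≤1 f f≤1 []       = ℕP.≤-refl
  product≤1 f f≤1 (x ∷ xs) = ℕP.*-mono-≤ (f≤1 x) (product≤1 f f≤1 xs)

  product≢0 : (f : A → ℕ) → ∀ xs → product (map f xs) ≢ 0 → ∀ {a} → a ∈ᴸ xs → f a ≢ 0
  product≢0 f (x ∷ xs) h (here refl) fx≡0 = h (cong (_* product (map f xs)) fx≡0)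
  product≢0 f (x ∷ xs) h (there a∈)       = product≢0 f xs
    (λ e → h (trans (cong (f x *_) e) (ℕP.*-zeroʳ (f x)))) a∈

*≢0 : ∀ m {n} → m * n ≢ 0 → m ≢ 0 × n ≢ 0
*≢0 m {n} h = (λ { refl → h refl }) , λ { refl → h (ℕP.*-zeroʳ m) }

length-allFin : ∀ n → length (allFin n) ≡ n
length-allFin n = length-tabulate {n = n} (λ i → i)

-- The two predicates

-- Common bound on the degree of both violation counts. It is cubic because a term of `W` makes ℓ +
-- 2 membership tests, each reading ℓ + 2 words of ℓ bits.
cube : ℕ → ℕ
cube ℓ = (2 + ℓ) ^ 3

module _ {ℓ : ℕ} (P : Parameters ℓ) where

  open Parameters P
  open Predicates P

  private
    n M : ℕ
    n = size ℓ
    M = listLength ℓ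

    1≤n : 1 ≤ n
    1≤n = ℕP.m^n>0 2 ℓ

    M^≤n^ : M ^ (2 + ℓ) ≤ n ^ (1 + ℓ)
    M^≤n^ = Equivalence.from (floorRoot-spec (1 + ℓ) (n ^ (1 + ℓ)) M) ℕP.≤-refl

    M≤n : M ≤ n
    M≤n = ℕP.≮⇒≥ λ n<M → ℕP.<-irrefl refl (begin-strict
      n ^ (1 + ℓ)      <⟨ ℕP.^-monoˡ-< (1 + ℓ) n<M ⟩
      M ^ (1 + ℓ)      ≤⟨ ℕP.m≤n*m (M ^ (1 + ℓ)) M {{ℕ.>-nonZero (ℕP.≤-trans (s≤s z≤n) n<M)}} ⟩
      M ^ (2 + ℓ)      ≤⟨ M^≤n^ ⟩
      n ^ (1 + ℓ)      ∎)
      where open ℕP.≤-Reasoning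

    M<2^ : M < 2 ^ (1 + ℓ)
    M<2^ = ℕP.≤-<-trans M≤n (ℕP.m<m+n n (ℕP.≤-trans 1≤n (ℕP.m≤m+n n 0)))

  depth-word : ∀ w t → Depth≤ ℓ (λ z → word w z t)
  depth-word w t = depth-map (Inverse.to name)
    (depth-weaken (ℕP.≤-reflexive (ℕP.*-identityʳ ℓ))
      (depth-tabulate (λ k z → lookup z (2 * (n * n) ↑ʳ combine t k)) (λ k → depth-lookup _)))

  depth-entry : ∀ w i j b → Depth≤ 1 (λ z → matrix w z i j b)
  depth-entry w i j b = depth-lookup _

  depth-entryIsZero : ∀ w i j → Depth≤ 2 (λ z → does (entryIsZero? (matrix w z) i j))
  depth-entryIsZero w i j = depth-zipWith (λ a b → does (a ≟ᵇ false) ∧ does (b ≟ᵇ false))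
    (depth-entry w i j b₁) (depth-entry w i j b₂)

  module φ₁-bound where

    private
      X : Vec Bool (inputBits ℓ 2) → Matrix n
      X = matrix 2
      u v : Vec Bool (inputBits ℓ 2) → Fin n
      u z = word 2 z zero
      v z = word 2 z (suc zero)

      match : Matrix n → Fin n → Fin n → Fin n → Bool
      match x i₁ i₂ j = (x i₁ j b₁ ∧ x i₂ j b₁) ∨ (x i₁ j b₂ ∧ x i₂ j b₂)

      match? : ∀ x i₁ i₂ j → Dec (match x i₁ i₂ j ≡ true)
      match? x i₁ i₂ j = match x i₁ i₂ j ≟ᵇ true

      -- Bad rows are counted entry by entry: deciding whether a whole row is bad could query all
      -- its n columns, while one entry needs 2 queries and there are only ℓn of them.
      entry : Fin (ℓ * n) → Fin ℓ × Fin n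
      entry = remQuot n

      nonzero? : ∀ x i₁ i₂ s → Dec (¬ EntryIsZero x (r (proj₁ (entry s)) i₁ i₂) (proj₂ (entry s)))
      nonzero? x i₁ i₂ s = ¬? (entryIsZero? x (r (proj₁ (entry s)) i₁ i₂) (proj₂ (entry s)))

      V : Vec Bool (inputBits ℓ 2) → ℕ
      V z = bit (does (u z FinP.≟ v z))
          + (violations (match? (X z) (u z) (v z)) (allFin n)
          +  violations (nonzero? (X z) (u z) (v z)) (allFin (ℓ * n)))

      -- The product unfolds to n + (n + ℓn): the equality test, rounded up from 1 to n, then the
      -- columns, then the entries of the ℓ rows.
      V≤ : ∀ z → V z ≤ (2 + ℓ) * n
      V≤ z = ℕP.+-mono-≤ (ℕP.≤-trans (bit≤1 (does (u z FinP.≟ v z))) 1≤n)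
        (ℕP.+-mono-≤
          (ℕP.≤-trans (violations≤length (match? (X z) (u z) (v z)) (allFin n))
            (ℕP.≤-reflexive (length-allFin n)))
          (ℕP.≤-trans (violations≤length (nonzero? (X z) (u z) (v z)) (allFin (ℓ * n)))
            (ℕP.≤-reflexive (length-allFin (ℓ * n)))))

      -- Both names are read first, at ℓ queries each; after that the rows are fixed and the test
      -- queries matrix bits at known places.
      depth-uv : ∀ {e} (f : Fin n → Fin n → Vec Bool (inputBits ℓ 2) → Bool) →
                 (∀ i₁ i₂ → Depth≤ e (f i₁ i₂)) →
                 Depth≤ (ℓ + (ℓ + e)) (λ z → bit (f (u z) (v z) z))
      depth-uv f fᴰ = depth-map bit
        (depth-bind {h = λ i₁ z → f i₁ (v z) z} (depth-word 2 zero) λ i₁ →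
          depth-bind {h = f i₁} (depth-word 2 (suc zero)) (fᴰ i₁))

      depth-and : ∀ i₁ i₂ j b → Depth≤ 2 (λ z → X z i₁ j b ∧ X z i₂ j b)
      depth-and i₁ i₂ j b = depth-zipWith _∧_ (depth-entry 2 i₁ j b) (depth-entry 2 i₂ j b)

      V-degree : Degree≤ (ℓ + (ℓ + 4)) (λ z → ι (V z))
      V-degree = degree-+ (λ z → bit (does (u z FinP.≟ v z))) _
        (Depth⇒Degree (depth-uv (λ i₁ i₂ _ → does (i₁ FinP.≟ i₂)) λ i₁ i₂ → depth-const _))
        (degree-+ (λ z → violations (match? (X z) (u z) (v z)) (allFin n)) _
          (degree-sum (λ j z → bit (not (does (match? (X z) (u z) (v z) j))))
            (λ j → depth-uv (λ i₁ i₂ z → not (does (match? (X z) i₁ i₂ j))) λ i₁ i₂ →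
              depth-zipWith (λ a b → not (does (a ∨ b ≟ᵇ true)))
                (depth-and i₁ i₂ j b₁) (depth-and i₁ i₂ j b₂))
            (allFin n))
          (degree-sum (λ s z → bit (not (does (nonzero? (X z) (u z) (v z) s))))
            (λ s → depth-uv (λ i₁ i₂ z → not (does (nonzero? (X z) i₁ i₂ s))) λ i₁ i₂ →
              -- `nonzero?` is already a negation, hence the double `not`; its 2 queries are padded
              -- to the 4 of the match test.
              depth-weaken (s≤s (s≤s z≤n)) (depth-map (not ∘ not) (depth-entryIsZero 2 _ _)))
            (allFin (ℓ * n))))

      V≡0⇒ : ∀ z → V z ≡ 0 → CleanMatchingPair (X z) (u z) (v z)
      V≡0⇒ z h = u≢v ,
        (λ j → violations≡0⇒ (match? (X z) (u z) (v z)) (allFin n)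
          (ℕP.m+n≡0⇒m≡0 _ rest) (∈-allFin j)) ,
        λ k (j , isZero) → violations≡0⇒ (nonzero? (X z) (u z) (v z)) (allFin (ℓ * n))
          (ℕP.m+n≡0⇒n≡0 (violations (match? (X z) (u z) (v z)) (allFin n)) rest) (∈-allFin (combine k j))
          (subst (λ (k , j) → EntryIsZero (X z) (r k (u z) (v z)) j) (sym (FinP.remQuot-combine k j)) isZero)
        where
        rest : _ ≡ 0
        rest = ℕP.m+n≡0⇒n≡0 (bit (does (u z FinP.≟ v z))) h
        u≢v : u z ≢ v z
        u≢v e = contradiction (trans (sym (cong bit (dec-true (u z FinP.≟ v z) e))) (ℕP.m+n≡0⇒m≡0 _ h)) λ ()

      V≡0⇐ : ∀ z → CleanMatchingPair (X z) (u z) (v z) → V z ≡ 0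
      V≡0⇐ z (u≢v , match , clean) = cong₂ _+_ (cong bit (dec-false (u z FinP.≟ v z) u≢v))
        (cong₂ _+_ (violations≡0⇐ (match? (X z) (u z) (v z)) match (allFin n))
                   (violations≡0⇐ (nonzero? (X z) (u z) (v z)) (λ s h → clean _ (_ , h)) (allFin (ℓ * n))))

    approx : ∀ {e} → 2 * ((2 + ℓ) * n) ≤ e * e → Approximationℚ φ₁ (e * (cube ℓ + cube ℓ))
    approx {e} h = isZero-approx {B = (2 + ℓ) * n} {e} {{ℕP.m*n≢0 (2 + ℓ) n {{_}} {{ℕ.>-nonZero 1≤n}}}} h
      {g = φ₁} {V = V} (weakenᴾ bound V-degree) V≤
      (λ z V≡0 → dec-true (cleanMatchingPair? (X z) (u z) (v z)) (V≡0⇒ z V≡0))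
      (λ z V≢0 → dec-false (cleanMatchingPair? (X z) (u z) (v z)) (V≢0 ∘ V≡0⇐ z))
      where
      bound : ℓ + (ℓ + 4) ≤ cube ℓ
      -- The added polynomial is (2 + ℓ)³ minus the degree, so the inequality becomes a ring
      -- identity on the unfolded power.
      bound = ℕP.≤-trans (ℕP.m≤m+n _ (ℓ * ℓ * ℓ + 6 * (ℓ * ℓ) + 10 * ℓ + 4)) (ℕP.≤-reflexive (expand ℓ))
        where
        expand : ∀ ℓ → ℓ + (ℓ + 4) + (ℓ * ℓ * ℓ + 6 * (ℓ * ℓ) + 10 * ℓ + 4)
                     ≡ (2 + ℓ) * ((2 + ℓ) * ((2 + ℓ) * 1))
        expand = solve-∀

  module φ₀-bound where

    private
      X : Vec Bool (inputBits ℓ (1 + M)) → Matrix n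
      X = matrix (1 + M)
      column : Vec Bool (inputBits ℓ (1 + M)) → Fin n
      column z = word (1 + M) z zero
      list : Vec Bool (inputBits ℓ (1 + M)) → Vec (Fin n) M
      list z = tabulate (word (1 + M) z ∘ suc)

      covered? : ∀ x j (A : Vec (Fin n) M) i → Dec (mem A i ≡ true ⊎ EntryIsZero x i j)
      covered? x j A i = (mem A i ≟ᵇ true) ⊎-dec entryIsZero? x i j

      term : Matrix n → Vec (Fin n) M → Fin n × Fin n → ℕ
      term x A (u , v) = E x A u v * (1 ∸ Z x u v)

      V : Vec Bool (inputBits ℓ (1 + M)) → ℕ
      V z = violations (covered? (X z) (column z) (list z)) (allFin n) + W (X z) (list z)

      term≤1 : ∀ x A p → term x A p ≤ 1
      term≤1 x A (u , v) = ℕP.*-mono-≤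
        (ℕP.*-mono-≤ (ℕP.*-mono-≤ (bit≤1 (mem A u)) (bit≤1 (mem A v)))
          (product≤1 (λ k → bit (mem A (r k u v))) (λ k → bit≤1 (mem A (r k u v))) (allFin ℓ)))
        (ℕP.m∸n≤m 1 (Z x u v))

      inside : ∀ x A → ((u , v) : Fin n × Fin n) → term x A (u , v) ≢ 0 →
               u ∈ elements A × v ∈ elements A × (∀ k → r k u v ∈ elements A)
      inside x A (u , v) h =
        mem⇒∈ A u (bit≢0 (proj₁ (*≢0 (bit (mem A u)) uv≢0))) ,
        mem⇒∈ A v (bit≢0 (proj₂ (*≢0 (bit (mem A u)) uv≢0))) ,
        λ k → mem⇒∈ A (r k u v)
          (bit≢0 (product≢0 (λ k → bit (mem A (r k u v))) (allFin ℓ) (proj₂ E≢0) (∈-allFin k)))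
        where
        E≢0 = *≢0 (bit (mem A u) * bit (mem A v)) (proj₁ (*≢0 (E x A u v) h))
        uv≢0 = proj₁ E≢0

      -- A nonzero term places u, v and every r_k(u,v) in `elements A`, whose size meets the
      -- hypothesis of `r-sparse`. The trivial bound n² would make the Chebyshev degree of order n
      -- instead of √n.
      W≤ : ∀ x A → W x A ≤ ℓ * n
      W≤ x A = ℕP.≤-trans
        (sum-filter≤ _ (λ (i , j) → i ∈? S ×-dec j ∈? S ×-dec FinP.all? (λ k → r k i j ∈? S))
          (term x A) (term≤1 x A) (inside x A) (pairs n))
        (r-sparse S (ℕP.≤-trans (ℕP.^-monoˡ-≤ (2 + ℓ) (∣elements∣≤ A)) M^≤n^))
        where
        S : Subset n
        S = elements A

      V≤ : ∀ z → V z ≤ (2 + ℓ) * n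
      V≤ z = ℕP.≤-trans
        (ℕP.+-mono-≤
          (ℕP.≤-trans (violations≤length (covered? (X z) (column z) (list z)) (allFin n))
            (ℕP.≤-reflexive (length-allFin n)))
          (W≤ (X z) (list z)))
        -- Rounded up by n so that both predicates use the same B.
        (ℕP.m≤n+m (n + ℓ * n) n)

      -- At most 1 + ℓ halvings, as M < 2^(1+ℓ), each reading a word of ℓ bits, and one more word
      -- for the final comparison.
      K : ℕ
      K = (1 + ℓ) * ℓ + ℓ

      depth-memList : ∀ i → Depth≤ K (λ z → mem (list z) i)
      depth-memList i = depth-mem list
        (λ p → depth-ext (λ z → sym (VecP.lookup∘tabulate (word (1 + M) z ∘ suc) p))
          (depth-word (1 + M) (suc p)))
        i (1 + ℓ) M<2^

      depth-term : ∀ p → Depth≤ (K + K + length (allFin ℓ) * K + 2) (λ z → term (X z) (list z) p)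
      depth-term (u , v) = depth-zipWith (λ m n → m * (1 ∸ n))
        (depth-zipWith _*_
          (depth-zipWith (λ a b → bit a * bit b) (depth-memList u) (depth-memList v))
          (depth-map product
            (depth-list (λ k z → bit (mem (list z) (r k u v))) (λ k → depth-map bit (depth-memList (r k u v)))
              (allFin ℓ))))
        (depth-zipWith (λ a b → (1 ∸ bit a) * (1 ∸ bit b))
          (depth-entry (1 + M) u v b₁) (depth-entry (1 + M) v v b₂))

      depth-covered : ∀ i → Depth≤ (ℓ + (K + 2))
        (λ z → bit (not (does (covered? (X z) (column z) (list z) i))))
      depth-covered i = depth-bind {h = λ j z → bit (not (does (covered? (X z) j (list z) i)))}
        (depth-word (1 + M) zero) λ j →
        depth-zipWith (λ a b → bit (not (does (a ≟ᵇ true) ∨ b)))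
          (depth-memList i) (depth-entryIsZero (1 + M) i j)

      V-degree : Degree≤ (cube ℓ) (λ z → ι (V z))
      V-degree = degree-+ (λ z → violations (covered? (X z) (column z) (list z)) (allFin n)) _
        (degree-sum (λ i z → bit (not (does (covered? (X z) (column z) (list z) i))))
          (λ i → depth-weaken bound₁ (depth-covered i)) (allFin n))
        (degree-sum (λ p z → term (X z) (list z) p) (λ p → depth-weaken bound₂ (depth-term p))
          (filter (λ (u , v) → ¬? (u FinP.≟ v)) (pairs n)))
        where
        expand₁ : ∀ ℓ → ℓ + ((1 + ℓ) * ℓ + ℓ + 2) + (ℓ * ℓ * ℓ + 5 * (ℓ * ℓ) + 9 * ℓ + 6)
                      ≡ (2 + ℓ) * ((2 + ℓ) * ((2 + ℓ) * 1))
        expand₁ = solve-∀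
        expand₂ : ∀ ℓ → ((1 + ℓ) * ℓ + ℓ) + ((1 + ℓ) * ℓ + ℓ) + ℓ * ((1 + ℓ) * ℓ + ℓ) + 2
                        + (2 * (ℓ * ℓ) + 8 * ℓ + 6)
                      ≡ (2 + ℓ) * ((2 + ℓ) * ((2 + ℓ) * 1))
        expand₂ = solve-∀
        bound₁ : ℓ + (K + 2) ≤ cube ℓ
        bound₁ = ℕP.≤-trans (ℕP.m≤m+n _ _) (ℕP.≤-reflexive (expand₁ ℓ))
        bound₂ : K + K + length (allFin ℓ) * K + 2 ≤ cube ℓ
        bound₂ = ℕP.≤-trans
          (ℕP.≤-reflexive (cong (λ m → K + K + m * K + 2) (length-allFin ℓ)))
          (ℕP.≤-trans (ℕP.m≤m+n _ _) (ℕP.≤-reflexive (expand₂ ℓ)))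

      V≡0⇒ : ∀ z → V z ≡ 0 → Valid (X z) (column z) (list z)
      V≡0⇒ z h =
        (λ i → violations≡0⇒ (covered? (X z) (column z) (list z)) (allFin n) (ℕP.m+n≡0⇒m≡0 _ h) (∈-allFin i)) ,
        ℕP.m+n≡0⇒n≡0 (violations (covered? (X z) (column z) (list z)) (allFin n)) h

      V≡0⇐ : ∀ z → Valid (X z) (column z) (list z) → V z ≡ 0
      V≡0⇐ z (covered , W≡0) =
        cong₂ _+_ (violations≡0⇐ (covered? (X z) (column z) (list z)) covered (allFin n)) W≡0

    approx : ∀ {e} → 2 * ((2 + ℓ) * n) ≤ e * e → Approximationℚ φ₀ (e * (cube ℓ + cube ℓ))
    approx {e} h = isZero-approx {B = (2 + ℓ) * n} {e} {{ℕP.m*n≢0 (2 + ℓ) n {{_}} {{ℕ.>-nonZero 1≤n}}}} h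
      {g = φ₀} {V = V} V-degree V≤
      (λ z V≡0 → dec-true (valid? (X z) (column z) (list z)) (V≡0⇒ z V≡0))
      (λ z V≢0 → dec-false (valid? (X z) (column z) (list z)) (V≢0 ∘ V≡0⇐ z))

-- Choice of the Chebyshev degree and the final count

-- 2^⌈ℓ/2⌉
√2^ : ℕ → ℕ
√2^ zero          = 1
√2^ (suc zero)    = 2
√2^ (suc (suc ℓ)) = 2 * √2^ ℓ

-- An integer stand-in for √n: the lower bound makes the Chebyshev degree large enough, the upper
-- one loses a factor 2 in the square. Steps of two multiply everything by 4 and keep the parities
-- apart.
√2^-bounds : ∀ ℓ → 2 ^ ℓ ≤ √2^ ℓ * √2^ ℓ × √2^ ℓ * √2^ ℓ ≤ 2 * 2 ^ ℓ
√2^-bounds zero          = s≤s z≤n , s≤s z≤n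
√2^-bounds (suc zero)    = s≤s (s≤s z≤n) , ℕP.≤-refl
√2^-bounds (suc (suc ℓ)) with √2^ ℓ | √2^-bounds ℓ
... | s | lower , upper =
  ℕP.≤-trans (ℕP.≤-reflexive (four (2 ^ ℓ)))
    (ℕP.≤-trans (ℕP.*-monoʳ-≤ 4 lower) (ℕP.≤-reflexive (sym (square s)))) ,
  ℕP.≤-trans (ℕP.≤-reflexive (square s))
    (ℕP.≤-trans (ℕP.*-monoʳ-≤ 4 upper) (ℕP.≤-reflexive (eight (2 ^ ℓ))))
  where
  four : ∀ m → 2 * (2 * m) ≡ 4 * m
  four = solve-∀
  square : ∀ s → (2 * s) * (2 * s) ≡ 4 * (s * s)
  square = solve-∀
  eight : ∀ m → 4 * (2 * m) ≡ 2 * (2 * (2 * m))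
  eight = solve-∀

-- An e with e² ≥ 2B for B = (2 + ℓ)n. Taking 2 + ℓ in place of its square root avoids a further
-- root, costs only a logarithmic factor, and absorbs the 2.
chebyshevDegree : ℕ → ℕ
chebyshevDegree ℓ = (2 + ℓ) * √2^ ℓ

chebyshevDegree-large : ∀ ℓ → 2 * ((2 + ℓ) * size ℓ) ≤ chebyshevDegree ℓ * chebyshevDegree ℓ
chebyshevDegree-large ℓ = begin
  2 * (b * 2 ^ ℓ)      ≤⟨ ℕP.*-mono-≤ (ℕP.m≤m+n 2 ℓ) (ℕP.*-monoʳ-≤ b (proj₁ (√2^-bounds ℓ))) ⟩
  b * (b * (s * s))    ≡⟨ regroup b s ⟩
  (b * s) * (b * s)    ∎
  where
  open ℕP.≤-Reasoning
  b = 2 + ℓ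
  s = √2^ ℓ
  regroup : ∀ b s → b * (b * (s * s)) ≡ (b * s) * (b * s)
  regroup = solve-∀

^-distribʳ-* : ∀ k m n → (m * n) ^ k ≡ m ^ k * n ^ k
^-distribʳ-* zero    m n = refl
^-distribʳ-* (suc k) m n = trans (cong (m * n *_) (^-distribʳ-* k m n)) (interchange m n (m ^ k) (n ^ k))
  where
  interchange : ∀ m n p q → m * n * (p * q) ≡ m * p * (n * q)
  interchange = solve-∀

totalDegree : ℕ → ℕ
totalDegree ℓ = chebyshevDegree ℓ * (cube ℓ + cube ℓ)

-- The constant collects 4 from doubling `cube`, 2^8 from 2 + ℓ ≤ 2ℓ, and 2 from rounding √n up. The
-- exponent 8 is twice 1 + 3, from `chebyshevDegree` and `cube`.
totalDegree-small : ∀ ℓ → 5 ≤ ℓ → totalDegree ℓ ^ 2 ≤ 4 * 2 ^ 8 * 2 * ℓ ^ 8 * 2 ^ ℓ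
totalDegree-small ℓ 5≤ℓ = begin
  (b * s * (b ^ 3 + b ^ 3)) ^ 2
    -- `b * b ^ 3` computes to `b ^ 4`, so the cube can be passed as an opaque factor.
    ≡⟨ regroup b s (b ^ 3) ⟩
  4 * (b ^ 4 * b ^ 4) * (s * s)
    ≡⟨ cong (λ m → 4 * m * (s * s)) (ℕP.^-distribˡ-+-* b 4 4) ⟨
  4 * b ^ 8 * (s * s)
    ≤⟨ ℕP.*-mono-≤ (ℕP.*-monoʳ-≤ 4 (ℕP.^-monoˡ-≤ 8 b≤2ℓ)) (proj₂ (√2^-bounds ℓ)) ⟩
  4 * (2 * ℓ) ^ 8 * (2 * 2 ^ ℓ)
    ≡⟨ cong (λ m → 4 * m * (2 * 2 ^ ℓ)) (^-distribʳ-* 8 2 ℓ) ⟩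
  4 * (2 ^ 8 * ℓ ^ 8) * (2 * 2 ^ ℓ)
    ≡⟨ collect 4 (2 ^ 8) 2 (ℓ ^ 8) (2 ^ ℓ) ⟩
  4 * 2 ^ 8 * 2 * ℓ ^ 8 * 2 ^ ℓ ∎
  where
  open ℕP.≤-Reasoning
  b = 2 + ℓ
  s = √2^ ℓ
  b≤2ℓ : b ≤ 2 * ℓ
  b≤2ℓ = ℕP.+-mono-≤ {2} {ℓ} (ℕP.≤-trans (s≤s (s≤s z≤n)) 5≤ℓ) (ℕP.m≤m+n ℓ 0)
  regroup : ∀ b s c → b * s * (c + c) * (b * s * (c + c) * 1) ≡ 4 * (b * c * (b * c)) * (s * s)
  regroup = solve-∀
  collect : ∀ a b c p q → a * (b * p) * (c * q) ≡ a * b * c * p * q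
  collect = solve-∀

Õ√n-intro : ∀ {N : ℕ → ℕ} (g : ∀ ℓ → 5 ≤ ℓ → BooleanFunction (N ℓ)) C c (D : ℕ → ℕ) →
            (∀ ℓ 5≤ℓ → Approximationℚ (g ℓ 5≤ℓ) (D ℓ)) →
            (∀ ℓ → 5 ≤ ℓ → D ℓ ^ 2 ≤ C * ℓ ^ c * 2 ^ ℓ) → ApproxDegreeIsÕ√n g
Õ√n-intro g C c D approx small =
  C , c , 0 , λ ℓ 5≤ℓ _ → D ℓ , approxDegree≤ (approx ℓ 5≤ℓ) , small ℓ 5≤ℓ

lemma4p1 : (P : ∀ (ℓ : ℕ) → 5 ≤ ℓ → Parameters ℓ) →
    ApproxDegreeIsÕ√n (λ ℓ 5≤ℓ → Predicates.φ₀ (P ℓ 5≤ℓ)) ×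
    ApproxDegreeIsÕ√n (λ ℓ 5≤ℓ → Predicates.φ₁ (P ℓ 5≤ℓ))
lemma4p1 P =
  Õ√n-intro (λ ℓ 5≤ℓ → Predicates.φ₀ (P ℓ 5≤ℓ)) (4 * 2 ^ 8 * 2) 8 totalDegree
    (λ ℓ 5≤ℓ → φ₀-bound.approx (P ℓ 5≤ℓ) {chebyshevDegree ℓ} (chebyshevDegree-large ℓ)) totalDegree-small ,
  Õ√n-intro (λ ℓ 5≤ℓ → Predicates.φ₁ (P ℓ 5≤ℓ)) (4 * 2 ^ 8 * 2) 8 totalDegree
    (λ ℓ 5≤ℓ → φ₁-bound.approx (P ℓ 5≤ℓ) {chebyshevDegree ℓ} (chebyshevDegree-large ℓ)) totalDegree-small
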